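{- For every composition $\alpha$, in $\mathfrak{m}\mathrm{QSym}$ one has $S(\tilde L_\alpha)=\hat L_{\omega(\alpha)}(-x_1,-x_2,\dots)$, where $S$ is the antipode of $\mathfrak{m}\mathrm{QSym}$.
   Context: Compositions: finite sequences of positive integers. For $\alpha=(\alpha_1,\dots,\alpha_k)$ a composition of $n$, $S_\alpha=\{\alpha_1,\dots,\alpha_1+\dots+\alpha_{k-1}\}\subseteq[n-1]$; $\omega(\alpha)$ is the composition of $n$ with $S_{\omega(\alpha)}=[n-1]\setminus S_{(\alpha_k,\dots,\alpha_1)}$. Fix $w\in\mathfrak S_n$ with $\{j:w_j>w_{j+1}\}=S_\alpha$ and a chain $p_1<\dots<p_n$. $\tilde L_\alpha=\sum_\sigma\prod_r x_r^{\#\{j:r\in\sigma(p_j)\}}$, the sum over maps $\sigma$ assigning finite nonempty sets of positive integers to the $p_j$ with $\max\sigma(p_j)\le\min\sigma(p_{j+1})$ if $w_j<w_{j+1}$ and $\max\sigma(p_j)<\min\sigma(p_{j+1})$ if $w_j>w_{j+1}$. $\hat L_\alpha$ is defined identically but with finite nonempty multisets, $x_r$ raised to the total multiplicity of $r$. $\tilde L_\emptyset=\hat L_\emptyset=1$. $\mathfrak{m}\mathrm{QSym}$ is the set of all (possibly infinite) $\mathbb{Z}$-linear combinations of the $\tilde L_\alpha$; it is a completed Hopf algebra with product of power series, coproduct $\Delta f=f(x_1,x_2,\dots,y_1,y_2,\dots)$ (explicitly $\Delta\tilde L_\alpha=\sum\tilde L_{\mathcal{C}(u)}\otimes\tilde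 L_{\mathcal{C}(u')}$ over $u\otimes u'$ equal to $w_1\cdots w_i\otimes w_{i+1}\cdots w_n$, $0\le i\le n$, or $w_1\cdots w_i\otimes w_i\cdots w_n$, $1\le i\le n$, where $\mathcal{C}$ of a word is the composition of its descent set), counit the constant term, and antipode $S$ the continuous linear map with $\sum S(f_1)f_2=\epsilon(f)=\sum f_1S(f_2)$. -}

module Defs where

open import Data.Nat using (ℕ; zero; suc; _+_; _∸_; _<ᵇ_; _≡ᵇ_; _≤_)
open import Data.Bool using (Bool; true; false; _∧_; _∨_; not; if_then_else_)
open import Data.List using (List; []; _∷_; map; foldr; reverse; replicate; zipWith; length; take; drop; concatMap; applyUpTo; upTo; _++_)
open import Data.Nat.ListAction using (sum)
open import Data.List.Relation.Unary.All using (All)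
open import Data.Integer as ℤ using (ℤ)
open import Data.Product using (Σ; _×_; _,_; proj₁; proj₂)
open import Relation.Binary.PropositionalEquality using (_≡_)

Comp : Set
Comp = List ℕ

IsComp : Comp → Set
IsComp α = All (1 ≤_) α

size : Comp → ℕ
size = sum

-- Descent indicator of S_α ⊆ [n-1]: a Bool list of length n-1
-- (n = |α| ≥ 1) whose j-th entry (j = 1..n-1) is true iff j ∈ S_α.
-- For α = ∅ it is the empty list.
descSet : Comp → List Bool
descSet []           = []
descSet (a ∷ [])     = replicate (a ∸ 1) false
descSet (a ∷ b ∷ as) = replicate (a ∸ 1) false ++ (true ∷ descSet (b ∷ as))

fromDesc : List Bool → Comp
fromDesc = go 1
  where
  go : ℕ → List Bool → Comp
  go c []            = c ∷ []
  go c (true  ∷ bs)  = c ∷ go 1 bs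
  go c (false ∷ bs)  = go (suc c) bs

ω : Comp → Comp
ω []      = []
ω (a ∷ α) = fromDesc (map not (descSet (reverse (a ∷ α))))

Word : Set
Word = List ℕ

desW : Word → List Bool
desW []            = []
desW (x ∷ [])      = []
desW (x ∷ y ∷ us)  = (y <ᵇ x) ∷ desW (y ∷ us)

C : Word → Comp
C []       = []
C (x ∷ us) = fromDesc (desW (x ∷ us))

-- A fixed permutation w(α) ∈ 𝔖_n with descent set S_α:
-- blocks of sizes α₁,…,αₖ, each increasing, the first block holding the
-- largest values, e.g. w(2,1,3) = 5 6 | 4 | 1 2 3.
wordOf : Comp → Word
wordOf []      = []
wordOf (a ∷ α) = applyUpTo (λ i → suc (size α + i)) a ++ wordOf α

-- Formal power series in x₁, x₂, … with ℤ coefficients.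
-- A monomial x₁^{e₁}⋯x_k^{e_k} is the exponent list e₁ ∷ … ∷ e_k ∷ []
-- (trailing zeros denote the same monomial; every series below has
-- coefficients invariant under adding trailing zeros).

Monomial : Set
Monomial = List ℕ

PS : Set
PS = Monomial → ℤ

boxes : List ℕ → List (List ℕ)
boxes []      = [] ∷ []
boxes (b ∷ bs) = concatMap (λ v → map (λ i → i ∷ v) (upTo (suc b))) (boxes bs)

vsub : List ℕ → List ℕ → List ℕ
vsub = zipWith _∸_

isZeroVec : List ℕ → Bool
isZeroVec = foldr (λ e r → (e ≡ᵇ 0) ∧ r) true

eqVec : List ℕ → List ℕ → Bool
eqVec []       []       = true
eqVec (x ∷ xs) (y ∷ ys) = (x ≡ᵇ y) ∧ eqVec xs ys
eqVec _        _        = false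

sumZ : List ℤ → ℤ
sumZ = foldr ℤ._+_ (ℤ.+ 0)

_⊕_ : PS → PS → PS
(f ⊕ g) m = f m ℤ.+ g m

_⊛_ : PS → PS → PS
(f ⊛ g) m = sumZ (map (λ v → f v ℤ.* g (vsub m v)) (boxes m))

onePS : PS
onePS m = if isZeroVec m then ℤ.+ 1 else ℤ.+ 0

_·_ : ℤ → PS → PS
(c · f) m = c ℤ.* f m

ΣPS : List PS → PS
ΣPS fs m = sumZ (map (λ f → f m) fs)

negVars : PS → PS
negVars f m = (if isEven (sum m) then ℤ.+ 1 else ℤ.- ℤ.+ 1) ℤ.* f m
  where
  isEven : ℕ → Bool
  isEven zero          = true
  isEven (suc zero)    = false
  isEven (suc (suc k)) = isEven k

-- Set-valued and multiset-valued P-partitions of the chain p₁<⋯<pₙ.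
-- A finite (multi)set of positive integers ≤ k is an exponent vector
-- of length k (entry r-1 = multiplicity of r).  Since only variables
-- x₁,…,x_k occur in a monomial of length k, larger values can never
-- occur in a σ contributing to that coefficient.

tuples : {A : Set} → ℕ → List A → List (List A)
tuples zero    xs = [] ∷ []
tuples (suc n) xs = concatMap (λ t → map (λ x → x ∷ t) xs) (tuples n xs)

minSupp : List ℕ → ℕ
minSupp []       = 0
minSupp (e ∷ es) = if e ≡ᵇ 0 then suc (minSupp es) else 0

maxSupp : List ℕ → ℕ
maxSupp es = go 0 0 es
  where
  go : ℕ → ℕ → List ℕ → ℕ
  go i acc []       = acc
  go i acc (e ∷ es) = go (suc i) (if e ≡ᵇ 0 then acc else i) es

nonempty : List ℕ → Bool
nonempty v = not (isZeroVec v)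

chainOK : List Bool → List (List ℕ) → Bool
chainOK (d ∷ ds) (s ∷ t ∷ ss) =
  (if d then maxSupp s <ᵇ minSupp t else maxSupp s <ᵇ suc (minSupp t))
  ∧ chainOK ds (t ∷ ss)
chainOK _ _ = true

vsumAll : ℕ → List (List ℕ) → List ℕ
vsumAll k = foldr (zipWith _+_) (replicate k 0)

count : {A : Set} → (A → Bool) → List A → ℕ
count p []       = 0
count p (x ∷ xs) = if p x then suc (count p xs) else count p xs

ppCount : Word → List (List ℕ) → Monomial → ℕ
ppCount w cands m =
  count (λ σ → foldr (λ s r → nonempty s ∧ r) true σ
               ∧ chainOK (desW w) σ
               ∧ eqVec (vsumAll (length m) σ) m)
        (tuples (length w) cands)

-- L̃_α : set-valued (each σ(p_j) a set: entries ≤ 1)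
Ltil : Comp → PS
Ltil α m = ℤ.+ ppCount (wordOf α) (boxes (replicate (length m) 1)) m

-- L̂_α : multiset-valued (multiplicities bounded by m, as they must be)
Lhat : Comp → PS
Lhat α m = ℤ.+ ppCount (wordOf α) (boxes m) m

ε : PS → ℤ
ε f = f []

-- Δ L̃_α = Σ L̃_C(u) ⊗ L̃_C(u') over the list of pairs (u , u'):
-- (w₁⋯wᵢ , w_{i+1}⋯wₙ) for 0 ≤ i ≤ n and (w₁⋯wᵢ , wᵢ⋯wₙ) for 1 ≤ i ≤ n.
cuts : Word → List (Word × Word)
cuts w = map (λ i → take i w , drop i w) (upTo (suc (length w)))
      ++ map (λ i → take (suc i) w , drop i w) (upTo (length w))

-- membership in 𝔪QSym: f = Σ_α c_α L̃_α (the coefficient of a monomial m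
-- only receives contributions from α with |α| ≤ deg m, since L̃_α has
-- no terms of degree < |α|)
compsOf : ℕ → List Comp
compsOf zero    = [] ∷ []
compsOf (suc n) = map fromDesc (tuples n (true ∷ false ∷ []))

compsUpTo : ℕ → List Comp
compsUpTo zero    = compsOf 0
compsUpTo (suc d) = compsUpTo d ++ compsOf (suc d)

InMQSym : PS → Set
InMQSym f = Σ (Comp → ℤ) (λ c → ∀ m → f m ≡ sumZ (map (λ α → c α ℤ.* Ltil α m) (compsUpTo (sum m))))

-- A (candidate) antipode, given by its values s α = S(L̃_α) on the basis,
-- landing in 𝔪QSym and satisfying Σ S(f₁) f₂ = ε(f) = Σ f₁ S(f₂) for
-- f = L̃_α (by continuity and linearity this is the antipode axiom).
record IsAntipode (s : Comp → PS) : Set where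
  field
    inMQSym : ∀ α → IsComp α → InMQSym (s α)
    left    : ∀ α → IsComp α → ∀ m →
      ΣPS (map (λ p → s (C (proj₁ p)) ⊛ Ltil (C (proj₂ p))) (cuts (wordOf α))) m
        ≡ ε (Ltil α) ℤ.* onePS m
    right   : ∀ α → IsComp α → ∀ m →
      ΣPS (map (λ p → Ltil (C (proj₁ p)) ⊛ s (C (proj₂ p))) (cuts (wordOf α))) m
        ≡ ε (Ltil α) ℤ.* onePS m

{-# OPTIONS --safe #-}
module Submission where

-- Words with the cuts defining Δ, and monomials with their factorisations, form coassociative coalgebras,
-- so functions on words × monomials form a monoid under convolution, in which the antipode axiom says that
-- S is right inverse to L̃.  In a single variable x, L̃ of a word of length n is xⁿ if the word increases and
-- 0 otherwise, and its inverse is yⁿ with y = − x/(1+x) if the word decreases and 0 otherwise.  Separating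
-- off the smallest variable writes L̃ as (one-variable L̃) ⋆ L̃ and L̂ of the reversed complemented word at − x
-- as itself ⋆ (one-variable inverse), so the latter is left inverse to L̃ by induction on the number of
-- variables, and hence equals S.

open import Defs
open import Data.Bool using (Bool; true; false; _∧_; not; if_then_else_)
open import Data.Bool.ListAction using (all)
open import Data.Bool.Properties using (∧-assoc; ∧-comm; ∧-identityʳ; ∧-zeroʳ; not-involutive)
open import Data.Integer as ℤ using (ℤ; -_; _+_; _*_; 0ℤ; 1ℤ)
open import Data.Integer.Properties using (+-identityˡ; +-identityʳ; +-assoc; +-comm; neg-involutive; *-identityˡ; *-identityʳ; *-zeroˡ; *-zeroʳ; *-assoc; *-comm; *-distribˡ-+; *-distribʳ-+)
open import Data.Integer.Tactic.RingSolver using (solve-∀)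
open import Data.List using (List; []; _∷_; _++_; [_]; _∷ʳ_; map; concatMap; length; reverse; replicate; zipWith; upTo; applyUpTo; take; drop; null; foldr)
open import Data.List.Properties using (++-assoc; ++-identityʳ; concatMap-cong; length-++; length-applyUpTo; length-drop; length-map; length-replicate; length-reverse; length-take; length-zipWith; map-++; map-concatMap; map-upTo; map-∘; reverse-++; unfold-reverse)
open import Data.List.Relation.Unary.All using ([]; _∷_)
open import Data.Nat as ℕ using (ℕ; zero; suc; _∸_; _≡ᵇ_; _<ᵇ_; _≤_; z≤n; s≤s)
import Data.Nat.Properties as ℕ
open import Data.Nat.ListAction using (sum)
open import Data.Product using (∃₂; _×_; _,_; proj₁; proj₂; uncurry)
open import Function using (_∘_; id)
open import Relation.Binary.PropositionalEquality hiding ([_])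

-- The factors of the word chosen for a composition are not themselves chosen words, so convolution
-- runs over arbitrary words; `C` carries the antipode axiom over to them, because only descents
-- matter. The value of y comes from the cuts that share a letter. If a word descends to some letter
-- and ascends from it, the cuts with a descending first and an ascending second factor are those
-- just before, at and just after that letter. They contribute x, xy and y times a common factor, so
-- (1+x)(1+y) must be 1. With t = -x this gives y = t + t² + ⋯, which counts the nonempty multisets
-- on one element: this is how multisets and signs enter. Inverting a convolution product reverses
-- its factors, and the inverse lives on descending words, hence the reversed and complemented word.
-- The shared letters also explain why L̃ factors at all: a set containing the smallest variable
-- together with others belongs to both factors of a cut that shares its letter.

private variable
  A B : Set

-- Finite integer sums over lists.

∑ : List A → (A → ℤ) → ℤ
∑ xs f = sumZ (map f xs)

∑₂ : List (A × B) → (A → B → ℤ) → ℤ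
∑₂ xs f = ∑ xs (uncurry f)

∑-cong : ∀ (xs : List A) {f g : A → ℤ} → (∀ x → f x ≡ g x) → ∑ xs f ≡ ∑ xs g
∑-cong []       eq = refl
∑-cong (x ∷ xs) eq = cong₂ _+_ (eq x) (∑-cong xs eq)

∑₂-cong : ∀ (xs : List (A × B)) {f g : A → B → ℤ} → (∀ x y → f x y ≡ g x y) → ∑₂ xs f ≡ ∑₂ xs g
∑₂-cong xs eq = ∑-cong xs (λ (x , y) → eq x y)

∑-zero : ∀ (xs : List A) {f : A → ℤ} → (∀ x → f x ≡ 0ℤ) → ∑ xs f ≡ 0ℤ
∑-zero []       eq = refl
∑-zero (x ∷ xs) eq = cong₂ _+_ (eq x) (∑-zero xs eq)

+-interchange : ∀ a b c d → (a + b) + (c + d) ≡ (a + c) + (b + d)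
+-interchange = solve-∀

∑-+ : ∀ (xs : List A) (f g : A → ℤ) → ∑ xs (λ x → f x + g x) ≡ ∑ xs f + ∑ xs g
∑-+ []       f g = refl
∑-+ (x ∷ xs) f g = trans (cong ((f x + g x) +_) (∑-+ xs f g)) (+-interchange (f x) (g x) (∑ xs f) (∑ xs g))

∑-*ˡ : ∀ (xs : List A) c (f : A → ℤ) → c * ∑ xs f ≡ ∑ xs (λ x → c * f x)
∑-*ˡ []       c f = *-zeroʳ c
∑-*ˡ (x ∷ xs) c f = trans (*-distribˡ-+ c (f x) (∑ xs f)) (cong (c * f x +_) (∑-*ˡ xs c f))

∑-*ʳ : ∀ (xs : List A) (f : A → ℤ) c → ∑ xs f * c ≡ ∑ xs (λ x → f x * c)
∑-*ʳ xs f c = trans (*-comm (∑ xs f) c) (trans (∑-*ˡ xs c f) (∑-cong xs (λ x → *-comm c (f x))))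

∑-++ : ∀ (xs ys : List A) (f : A → ℤ) → ∑ (xs ++ ys) f ≡ ∑ xs f + ∑ ys f
∑-++ []       ys f = sym (+-identityˡ _)
∑-++ (x ∷ xs) ys f = trans (cong (f x +_) (∑-++ xs ys f)) (sym (+-assoc (f x) _ _))

∑-map : ∀ (g : A → B) xs (f : B → ℤ) → ∑ (map g xs) f ≡ ∑ xs (f ∘ g)
∑-map g []       f = refl
∑-map g (x ∷ xs) f = cong (f (g x) +_) (∑-map g xs f)

∑-concatMap : ∀ (g : A → List B) xs (f : B → ℤ) → ∑ (concatMap g xs) f ≡ ∑ xs (λ x → ∑ (g x) f)
∑-concatMap g []       f = refl
∑-concatMap g (x ∷ xs) f = trans (∑-++ (g x) _ f) (cong (∑ (g x) f +_) (∑-concatMap g xs f))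

∑-swap : ∀ (xs : List A) (ys : List B) (f : A → B → ℤ) →
         ∑ xs (λ x → ∑ ys (f x)) ≡ ∑ ys (λ y → ∑ xs (λ x → f x y))
∑-swap []       ys f = sym (∑-zero ys (λ _ → refl))
∑-swap (x ∷ xs) ys f = trans (cong (∑ ys (f x) +_) (∑-swap xs ys f)) (sym (∑-+ ys (f x) _))

-- Comultiplications as lists of pairs

splits : ℕ → List (ℕ × ℕ)
splits zero    = (0 , 0) ∷ []
splits (suc e) = (0 , suc e) ∷ map (λ (i , j) → suc i , j) (splits e)

-- Both factors are carried along, where `⊛` recovers the second by the truncated subtraction
-- `vsub`; coassociativity then becomes an induction.
boxSplits : Monomial → List (Monomial × Monomial)
boxSplits []      = ([] , []) ∷ []
boxSplits (e ∷ m) = concatMap (λ (i , j) → map (λ (v , v′) → i ∷ v , j ∷ v′) (boxSplits m)) (splits e)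

-- The two families of `cuts` merged into one recursion: the second pair is the cut that shares the
-- first letter.
wordCuts : List A → List (List A × List A)
wordCuts []      = ([] , []) ∷ []
wordCuts (x ∷ w) = ([] , x ∷ w) ∷ ([ x ] , x ∷ w) ∷ map (λ (u , u′) → x ∷ u , u′) (wordCuts w)

∑-splits-suc : ∀ e (φ : ℕ → ℕ → ℤ) →
  ∑₂ (splits (suc e)) φ ≡ φ 0 (suc e) + ∑₂ (splits e) (λ i j → φ (suc i) j)
∑-splits-suc e φ = cong (φ 0 (suc e) +_) (∑-map _ (splits e) _)

-- Peeling off the last pair, against `∑-splits-suc` which peels off the first, shifts two sums
-- relative to each other by one power of the variable; `∑-letterCuts-ascent` needs both.
∑-splits-sucʳ : ∀ e (φ : ℕ → ℕ → ℤ) →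
  ∑₂ (splits (suc e)) φ ≡ ∑₂ (splits e) (λ i j → φ i (suc j)) + φ (suc e) 0
∑-splits-sucʳ zero    φ = regroup (φ 0 1) (φ 1 0)
  where
  regroup : ∀ a b → a + (b + 0ℤ) ≡ (a + 0ℤ) + b
  regroup = solve-∀
∑-splits-sucʳ (suc e) φ = begin
  ∑₂ (splits (suc (suc e))) φ
    ≡⟨ ∑-splits-suc (suc e) φ ⟩
  φ 0 (suc (suc e)) + ∑₂ (splits (suc e)) (λ i j → φ (suc i) j)
    ≡⟨ cong (φ 0 (suc (suc e)) +_) (∑-splits-sucʳ e (λ i j → φ (suc i) j)) ⟩
  φ 0 (suc (suc e)) + (∑₂ (splits e) (λ i j → φ (suc i) (suc j)) + φ (suc (suc e)) 0)
    ≡⟨ +-assoc (φ 0 (suc (suc e))) _ _ ⟨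
  (φ 0 (suc (suc e)) + ∑₂ (splits e) (λ i j → φ (suc i) (suc j))) + φ (suc (suc e)) 0
    ≡⟨ cong (_+ φ (suc (suc e)) 0) (∑-splits-suc e (λ i j → φ i (suc j))) ⟨
  ∑₂ (splits (suc e)) (λ i j → φ i (suc j)) + φ (suc (suc e)) 0 ∎
  where open ≡-Reasoning

∑-boxSplits-∷ : ∀ e m (φ : Monomial → Monomial → ℤ) →
  ∑₂ (boxSplits (e ∷ m)) φ ≡ ∑₂ (splits e) (λ i j → ∑₂ (boxSplits m) (λ v v′ → φ (i ∷ v) (j ∷ v′)))
∑-boxSplits-∷ e m φ = trans (∑-concatMap _ (splits e) _) (∑-cong (splits e) (λ _ → ∑-map _ (boxSplits m) _))

∑-wordCuts-∷ : ∀ (x : A) w (φ : List A → List A → ℤ) →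
  ∑₂ (wordCuts (x ∷ w)) φ ≡ φ [] (x ∷ w) + (φ [ x ] (x ∷ w) + ∑₂ (wordCuts w) (λ u u′ → φ (x ∷ u) u′))
∑-wordCuts-∷ x w φ = cong (λ z → φ [] (x ∷ w) + (φ [ x ] (x ∷ w) + z)) (∑-map _ (wordCuts w) _)

-- The two lists of triples agree only up to order, so they are compared through sums of an
-- arbitrary `φ`. The property is stated at a single element so that an induction hypothesis can be
-- passed to `⊗-coassoc`.
CoassociativeAt : (A → List (A × A)) → A → Set
CoassociativeAt {A} D x = ∀ (φ : A → A → A → ℤ) →
  ∑₂ (D x) (λ a b → ∑₂ (D a) (λ c d → φ c d b)) ≡ ∑₂ (D x) (λ a b → ∑₂ (D b) (λ c d → φ a c d))

splits-coassoc : ∀ e → CoassociativeAt splits e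
splits-coassoc zero    φ = refl
splits-coassoc (suc e) φ = begin
  ∑₂ (splits (suc e)) (λ a b → ∑₂ (splits a) (λ c d → φ c d b))
    ≡⟨ ∑-splits-suc e (λ a b → ∑₂ (splits a) (λ c d → φ c d b)) ⟩
  (φ 0 0 (suc e) + 0ℤ) + ∑₂ (splits e) (λ a b → ∑₂ (splits (suc a)) (λ c d → φ c d b))
    ≡⟨ cong₂ _+_ (+-identityʳ (φ 0 0 (suc e))) (∑₂-cong (splits e) (λ a b → ∑-splits-suc a (λ c d → φ c d b))) ⟩
  φ 0 0 (suc e) + ∑₂ (splits e) (λ a b → φ 0 (suc a) b + ∑₂ (splits a) (λ c d → φ (suc c) d b))
    ≡⟨ cong (φ 0 0 (suc e) +_) (∑-+ (splits e) _ _) ⟩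
  φ 0 0 (suc e) + (∑₂ (splits e) (λ a b → φ 0 (suc a) b) + ∑₂ (splits e) (λ a b → ∑₂ (splits a) (λ c d → φ (suc c) d b)))
    ≡⟨ +-assoc (φ 0 0 (suc e)) _ _ ⟨
  (φ 0 0 (suc e) + ∑₂ (splits e) (λ a b → φ 0 (suc a) b)) + ∑₂ (splits e) (λ a b → ∑₂ (splits a) (λ c d → φ (suc c) d b))
    ≡⟨ cong₂ _+_ (sym (∑-splits-suc e (φ 0))) (splits-coassoc e (φ ∘ suc)) ⟩
  ∑₂ (splits (suc e)) (φ 0) + ∑₂ (splits e) (λ a b → ∑₂ (splits b) (φ (suc a)))
    ≡⟨ ∑-splits-suc e (λ a b → ∑₂ (splits b) (φ a)) ⟨
  ∑₂ (splits (suc e)) (λ a b → ∑₂ (splits b) (φ a)) ∎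
  where open ≡-Reasoning

-- The letter `x` may be shared by up to three factors. Sorting the triples by how they begin, each
-- side becomes the same seven sums `p` to `v`.
wordCuts-coassoc : ∀ (w : List A) → CoassociativeAt wordCuts w
wordCuts-coassoc []      φ = refl
wordCuts-coassoc (x ∷ w) φ = begin
  ∑₂ (wordCuts (x ∷ w)) (λ a b → ∑₂ (wordCuts a) (λ c d → φ c d b))
    ≡⟨ ∑-wordCuts-∷ x w (λ a b → ∑₂ (wordCuts a) (λ c d → φ c d b)) ⟩
  (p + 0ℤ) + ((q + (s + (r + 0ℤ))) + ∑₂ (wordCuts w) (λ a b → ∑₂ (wordCuts (x ∷ a)) (λ c d → φ c d b)))
    ≡⟨ cong (λ z → (p + 0ℤ) + ((q + (s + (r + 0ℤ))) + z)) (begin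
         ∑₂ (wordCuts w) (λ a b → ∑₂ (wordCuts (x ∷ a)) (λ c d → φ c d b))
           ≡⟨ ∑₂-cong (wordCuts w) (λ a b → ∑-wordCuts-∷ x a (λ c d → φ c d b)) ⟩
         ∑₂ (wordCuts w) (λ a b → φ [] (x ∷ a) b + (φ [ x ] (x ∷ a) b + ∑₂ (wordCuts a) (λ c d → φ (x ∷ c) d b)))
           ≡⟨ ∑-+ (wordCuts w) _ _ ⟩
         t + ∑₂ (wordCuts w) (λ a b → φ [ x ] (x ∷ a) b + ∑₂ (wordCuts a) (λ c d → φ (x ∷ c) d b))
           ≡⟨ cong (t +_) (∑-+ (wordCuts w) _ _) ⟩
         t + (u + ∑₂ (wordCuts w) (λ a b → ∑₂ (wordCuts a) (λ c d → φ (x ∷ c) d b)))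
           ≡⟨ cong (λ z → t + (u + z)) (wordCuts-coassoc w (φ ∘ (x ∷_))) ⟩
         t + (u + v) ∎) ⟩
  (p + 0ℤ) + ((q + (s + (r + 0ℤ))) + (t + (u + v)))
    ≡⟨ rearrange p q r s t u v ⟩
  (p + (q + t)) + ((r + (s + u)) + v)
    ≡⟨ cong₂ (λ y z → y + (z + v)) (∑-wordCuts-∷ x w (φ [])) (∑-wordCuts-∷ x w (φ [ x ])) ⟨
  ∑₂ (wordCuts (x ∷ w)) (φ []) + (∑₂ (wordCuts (x ∷ w)) (φ [ x ]) + v)
    ≡⟨ ∑-wordCuts-∷ x w (λ a b → ∑₂ (wordCuts b) (φ a)) ⟨
  ∑₂ (wordCuts (x ∷ w)) (λ a b → ∑₂ (wordCuts b) (φ a)) ∎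
  where
  open ≡-Reasoning
  p = φ [] [] (x ∷ w)
  q = φ [] [ x ] (x ∷ w)
  r = φ [ x ] [] (x ∷ w)
  s = φ [ x ] [ x ] (x ∷ w)
  t = ∑₂ (wordCuts w) (λ a b → φ [] (x ∷ a) b)
  u = ∑₂ (wordCuts w) (λ a b → φ [ x ] (x ∷ a) b)
  v = ∑₂ (wordCuts w) (λ a b → ∑₂ (wordCuts b) (λ c d → φ (x ∷ a) c d))
  rearrange : ∀ p q r s t u v → (p + 0ℤ) + ((q + (s + (r + 0ℤ))) + (t + (u + v))) ≡ (p + (q + t)) + ((r + (s + u)) + v)
  rearrange = solve-∀

∑₂-swap : ∀ {A′ B′ : Set} (xs : List (A × B)) (ys : List (A′ × B′)) (f : A → B → A′ → B′ → ℤ) →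
          ∑₂ xs (λ a b → ∑₂ ys (f a b)) ≡ ∑₂ ys (λ c d → ∑₂ xs (λ a b → f a b c d))
∑₂-swap xs ys f = ∑-swap xs ys (λ (a , b) (c , d) → f a b c d)

-- The two comultiplications act on different components, so the sums can be interchanged until each
-- coassociativity applies by itself. This serves both to add a variable to a monomial and to join
-- words with monomials.
⊗-coassoc : ∀ (D : A → List (A × A)) (E : B → List (B × B)) →
  ∀ x y → CoassociativeAt D x → CoassociativeAt E y → ∀ (φ : A → B → A → B → A → B → ℤ) →
  ∑₂ (D x) (λ a b → ∑₂ (E y) (λ a′ b′ → ∑₂ (D a) (λ c d → ∑₂ (E a′) (λ c′ d′ → φ c c′ d d′ b b′)))) ≡
  ∑₂ (D x) (λ a b → ∑₂ (E y) (λ a′ b′ → ∑₂ (D b) (λ c d → ∑₂ (E b′) (λ c′ d′ → φ a a′ c c′ d d′))))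
⊗-coassoc D E x y D-coassoc E-coassoc φ = begin
  ∑₂ (D x) (λ a b → ∑₂ (E y) (λ a′ b′ → ∑₂ (D a) (λ c d → ∑₂ (E a′) (λ c′ d′ → φ c c′ d d′ b b′))))
    ≡⟨ ∑₂-cong (D x) (λ a b → ∑₂-swap (E y) (D a) _) ⟩
  ∑₂ (D x) (λ a b → ∑₂ (D a) (λ c d → ∑₂ (E y) (λ a′ b′ → ∑₂ (E a′) (λ c′ d′ → φ c c′ d d′ b b′))))
    ≡⟨ D-coassoc (λ c d b → ∑₂ (E y) (λ a′ b′ → ∑₂ (E a′) (λ c′ d′ → φ c c′ d d′ b b′))) ⟩
  ∑₂ (D x) (λ a b → ∑₂ (D b) (λ c d → ∑₂ (E y) (λ a′ b′ → ∑₂ (E a′) (λ c′ d′ → φ a c′ c d′ d b′))))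
    ≡⟨ ∑₂-cong (D x) (λ a b → ∑₂-cong (D b) (λ c d → E-coassoc (λ c′ d′ b′ → φ a c′ c d′ d b′))) ⟩
  ∑₂ (D x) (λ a b → ∑₂ (D b) (λ c d → ∑₂ (E y) (λ a′ b′ → ∑₂ (E b′) (λ c′ d′ → φ a a′ c c′ d d′))))
    ≡⟨ ∑₂-cong (D x) (λ a b → ∑₂-swap (D b) (E y) _) ⟩
  ∑₂ (D x) (λ a b → ∑₂ (E y) (λ a′ b′ → ∑₂ (D b) (λ c d → ∑₂ (E b′) (λ c′ d′ → φ a a′ c c′ d d′)))) ∎
  where open ≡-Reasoning

boxSplits-coassoc : ∀ m → CoassociativeAt boxSplits m
boxSplits-coassoc []      φ = refl
boxSplits-coassoc (e ∷ m) φ = begin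
  ∑₂ (boxSplits (e ∷ m)) (λ a b → ∑₂ (boxSplits a) (λ c d → φ c d b))
    ≡⟨ ∑-boxSplits-∷ e m (λ a b → ∑₂ (boxSplits a) (λ c d → φ c d b)) ⟩
  ∑₂ (splits e) (λ i j → ∑₂ (boxSplits m) (λ a b → ∑₂ (boxSplits (i ∷ a)) (λ c d → φ c d (j ∷ b))))
    ≡⟨ ∑₂-cong (splits e) (λ i j → ∑₂-cong (boxSplits m) (λ a b → ∑-boxSplits-∷ i a (λ c d → φ c d (j ∷ b)))) ⟩
  ∑₂ (splits e) (λ i j → ∑₂ (boxSplits m) (λ a b → ∑₂ (splits i) (λ k l → ∑₂ (boxSplits a) (λ c d → φ (k ∷ c) (l ∷ d) (j ∷ b)))))
    ≡⟨ ⊗-coassoc splits boxSplits e m (splits-coassoc e) (boxSplits-coassoc m) (λ k c l d j b → φ (k ∷ c) (l ∷ d) (j ∷ b)) ⟩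
  ∑₂ (splits e) (λ i j → ∑₂ (boxSplits m) (λ a b → ∑₂ (splits j) (λ k l → ∑₂ (boxSplits b) (λ c d → φ (i ∷ a) (k ∷ c) (l ∷ d)))))
    ≡⟨ ∑₂-cong (splits e) (λ i j → ∑₂-cong (boxSplits m) (λ a b → ∑-boxSplits-∷ j b (φ (i ∷ a)))) ⟨
  ∑₂ (splits e) (λ i j → ∑₂ (boxSplits m) (λ a b → ∑₂ (boxSplits (j ∷ b)) (φ (i ∷ a))))
    ≡⟨ ∑-boxSplits-∷ e m (λ a b → ∑₂ (boxSplits b) (φ a)) ⟨
  ∑₂ (boxSplits (e ∷ m)) (λ a b → ∑₂ (boxSplits b) (φ a)) ∎
  where open ≡-Reasoning

⟦_⟧ : Bool → ℤ
⟦ b ⟧ = if b then 1ℤ else 0ℤ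

⟦∧⟧ : ∀ b c → ⟦ b ∧ c ⟧ ≡ ⟦ b ⟧ * ⟦ c ⟧
⟦∧⟧ true  c = sym (*-identityˡ ⟦ c ⟧)
⟦∧⟧ false c = sym (*-zeroˡ ⟦ c ⟧)

Counitalˡ Counitalʳ : (A → List (A × A)) → (A → Bool) → Set
Counitalˡ {A} D z = ∀ x (f : A → ℤ) → ∑₂ (D x) (λ a b → ⟦ z a ⟧ * f b) ≡ f x
Counitalʳ {A} D z = ∀ x (f : A → ℤ) → ∑₂ (D x) (λ a b → ⟦ z b ⟧ * f a) ≡ f x

1*a+0 : ∀ a → 1ℤ * a + 0ℤ ≡ a
1*a+0 = solve-∀

splits-counitˡ : Counitalˡ splits (_≡ᵇ 0)
splits-counitˡ zero    f = 1*a+0 (f 0)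
splits-counitˡ (suc e) f =
  trans (∑-splits-suc e (λ a b → ⟦ a ≡ᵇ 0 ⟧ * f b))
    (trans (cong (1ℤ * f (suc e) +_) (∑-zero (splits e) (λ _ → refl))) (1*a+0 (f (suc e))))

splits-counitʳ : Counitalʳ splits (_≡ᵇ 0)
splits-counitʳ zero    f = 1*a+0 (f 0)
splits-counitʳ (suc e) f =
  trans (∑-splits-suc e (λ a b → ⟦ b ≡ᵇ 0 ⟧ * f a)) (trans (+-identityˡ _) (splits-counitʳ e (f ∘ suc)))


boxSplits-counitˡ : Counitalˡ boxSplits isZeroVec
boxSplits-counitˡ []      f = 1*a+0 (f [])
boxSplits-counitˡ (e ∷ m) f = begin
  ∑₂ (boxSplits (e ∷ m)) (λ v v′ → ⟦ isZeroVec v ⟧ * f v′)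
    ≡⟨ ∑-boxSplits-∷ e m (λ v v′ → ⟦ isZeroVec v ⟧ * f v′) ⟩
  ∑₂ (splits e) (λ i j → ∑₂ (boxSplits m) (λ v v′ → ⟦ (i ≡ᵇ 0) ∧ isZeroVec v ⟧ * f (j ∷ v′)))
    ≡⟨ ∑₂-cong (splits e) (λ i j → trans
         (∑₂-cong (boxSplits m) (λ v v′ → trans (cong (_* f (j ∷ v′)) (⟦∧⟧ (i ≡ᵇ 0) (isZeroVec v))) (*-assoc ⟦ i ≡ᵇ 0 ⟧ _ _)))
         (trans (sym (∑-*ˡ (boxSplits m) ⟦ i ≡ᵇ 0 ⟧ _))
           (cong (⟦ i ≡ᵇ 0 ⟧ *_) (boxSplits-counitˡ m (λ v′ → f (j ∷ v′)))))) ⟩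
  ∑₂ (splits e) (λ i j → ⟦ i ≡ᵇ 0 ⟧ * f (j ∷ m))
    ≡⟨ splits-counitˡ e (λ j → f (j ∷ m)) ⟩
  f (e ∷ m) ∎
  where open ≡-Reasoning

boxSplits-counitʳ : Counitalʳ boxSplits isZeroVec
boxSplits-counitʳ []      f = 1*a+0 (f [])
boxSplits-counitʳ (e ∷ m) f = begin
  ∑₂ (boxSplits (e ∷ m)) (λ v v′ → ⟦ isZeroVec v′ ⟧ * f v)
    ≡⟨ ∑-boxSplits-∷ e m (λ v v′ → ⟦ isZeroVec v′ ⟧ * f v) ⟩
  ∑₂ (splits e) (λ i j → ∑₂ (boxSplits m) (λ v v′ → ⟦ (j ≡ᵇ 0) ∧ isZeroVec v′ ⟧ * f (i ∷ v)))
    ≡⟨ ∑₂-cong (splits e) (λ i j → trans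
         (∑₂-cong (boxSplits m) (λ v v′ → trans (cong (_* f (i ∷ v)) (⟦∧⟧ (j ≡ᵇ 0) (isZeroVec v′))) (*-assoc ⟦ j ≡ᵇ 0 ⟧ _ _)))
         (trans (sym (∑-*ˡ (boxSplits m) ⟦ j ≡ᵇ 0 ⟧ _))
           (cong (⟦ j ≡ᵇ 0 ⟧ *_) (boxSplits-counitʳ m (λ v → f (i ∷ v)))))) ⟩
  ∑₂ (splits e) (λ i j → ⟦ j ≡ᵇ 0 ⟧ * f (i ∷ m))
    ≡⟨ splits-counitʳ e (λ i → f (i ∷ m)) ⟩
  f (e ∷ m) ∎
  where open ≡-Reasoning

wordCuts-counitˡ : Counitalˡ (wordCuts {A}) null
wordCuts-counitˡ []      f = 1*a+0 (f [])
wordCuts-counitˡ (x ∷ w) f =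
  trans (∑-wordCuts-∷ x w (λ a b → ⟦ null a ⟧ * f b))
    (trans (cong (λ z → 1ℤ * f (x ∷ w) + (0ℤ + z)) (∑-zero (wordCuts w) (λ _ → refl))) (1*a+0 (f (x ∷ w))))

wordCuts-counitʳ : Counitalʳ (wordCuts {A}) null
wordCuts-counitʳ []      f = 1*a+0 (f [])
wordCuts-counitʳ (x ∷ w) f =
  trans (∑-wordCuts-∷ x w (λ a b → ⟦ null b ⟧ * f a))
    (trans (+-identityˡ _) (trans (+-identityˡ _) (wordCuts-counitʳ w (f ∘ (x ∷_)))))

-- Convolution of functions on words × monomials

Family : Set → Set
Family A = List A → Monomial → ℤ

infixl 7 _⋆_

_⋆_ : Family A → Family A → Family A
(F ⋆ G) w m = ∑₂ (wordCuts w) λ u u′ → ∑₂ (boxSplits m) λ v v′ → F u v * G u′ v′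

δ : Family A
δ w m = ⟦ null w ⟧ * ⟦ isZeroVec m ⟧

⋆-congˡ : ∀ (F : Family A) {G G′ : Family A} → (∀ w m → G w m ≡ G′ w m) → ∀ w m → (F ⋆ G) w m ≡ (F ⋆ G′) w m
⋆-congˡ F G≡ w m = ∑₂-cong (wordCuts w) λ u u′ → ∑₂-cong (boxSplits m) λ v v′ → cong (F u v *_) (G≡ u′ v′)

⋆-congʳ : ∀ (H : Family A) {F F′ : Family A} → (∀ w m → F w m ≡ F′ w m) → ∀ w m → (F ⋆ H) w m ≡ (F′ ⋆ H) w m
⋆-congʳ H F≡ w m = ∑₂-cong (wordCuts w) λ u u′ → ∑₂-cong (boxSplits m) λ v v′ → cong (_* H u′ v′) (F≡ u v)

⋆-assoc : ∀ (F G H : Family A) w m → ((F ⋆ G) ⋆ H) w m ≡ (F ⋆ (G ⋆ H)) w m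
⋆-assoc F G H w m = begin
  ((F ⋆ G) ⋆ H) w m
    ≡⟨ (∑₂-cong (wordCuts w) λ u u′ → ∑₂-cong (boxSplits m) λ v v′ →
          trans (∑-*ʳ (wordCuts u) _ (H u′ v′)) (∑₂-cong (wordCuts u) λ a b → ∑-*ʳ (boxSplits v) _ (H u′ v′))) ⟩
  (∑₂ (wordCuts w) λ u u′ → ∑₂ (boxSplits m) λ v v′ → ∑₂ (wordCuts u) λ a b → ∑₂ (boxSplits v) λ c d →
     F a c * G b d * H u′ v′)
    ≡⟨ ⊗-coassoc wordCuts boxSplits w m (wordCuts-coassoc w) (boxSplits-coassoc m) (λ a c b d u v → F a c * G b d * H u v) ⟩
  (∑₂ (wordCuts w) λ u u′ → ∑₂ (boxSplits m) λ v v′ → ∑₂ (wordCuts u′) λ a b → ∑₂ (boxSplits v′) λ c d →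
     F u v * G a c * H b d)
    ≡⟨ (∑₂-cong (wordCuts w) λ u u′ → ∑₂-cong (boxSplits m) λ v v′ →
          trans (∑₂-cong (wordCuts u′) λ a b →
                   trans (∑₂-cong (boxSplits v′) λ c d → *-assoc (F u v) (G a c) (H b d))
                         (sym (∑-*ˡ (boxSplits v′) (F u v) _)))
                (sym (∑-*ˡ (wordCuts u′) (F u v) _))) ⟩
  (F ⋆ (G ⋆ H)) w m ∎
  where open ≡-Reasoning

⋆-identityˡ : ∀ (F : Family A) w m → (δ ⋆ F) w m ≡ F w m
⋆-identityˡ F w m = begin
  (δ ⋆ F) w m
    ≡⟨ (∑₂-cong (wordCuts w) λ u u′ → trans
          (∑₂-cong (boxSplits m) λ v v′ → *-assoc ⟦ null u ⟧ ⟦ isZeroVec v ⟧ (F u′ v′))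
          (trans (sym (∑-*ˡ (boxSplits m) ⟦ null u ⟧ _)) (cong (⟦ null u ⟧ *_) (boxSplits-counitˡ m (F u′))))) ⟩
  ∑₂ (wordCuts w) (λ u u′ → ⟦ null u ⟧ * F u′ m)
    ≡⟨ wordCuts-counitˡ w (λ u′ → F u′ m) ⟩
  F w m ∎
  where open ≡-Reasoning

⋆-identityʳ : ∀ (F : Family A) w m → (F ⋆ δ) w m ≡ F w m
⋆-identityʳ F w m = begin
  (F ⋆ δ) w m
    ≡⟨ (∑₂-cong (wordCuts w) λ u u′ → trans
          (∑₂-cong (boxSplits m) λ v v′ → rot (F u v) ⟦ null u′ ⟧ ⟦ isZeroVec v′ ⟧)
          (trans (sym (∑-*ˡ (boxSplits m) ⟦ null u′ ⟧ _)) (cong (⟦ null u′ ⟧ *_) (boxSplits-counitʳ m (F u))))) ⟩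
  ∑₂ (wordCuts w) (λ u u′ → ⟦ null u′ ⟧ * F u m)
    ≡⟨ wordCuts-counitʳ w (λ u → F u m) ⟩
  F w m ∎
  where
  open ≡-Reasoning
  rot : ∀ a b c → a * (b * c) ≡ b * (c * a)
  rot = solve-∀

⋆-inverse-unique : ∀ (F G H : Family A) → (∀ w m → (F ⋆ G) w m ≡ δ w m) → (∀ w m → (G ⋆ H) w m ≡ δ w m) →
                   ∀ w m → H w m ≡ F w m
⋆-inverse-unique F G H FG≡δ GH≡δ w m = begin
  H w m             ≡⟨ ⋆-identityˡ H w m ⟨
  (δ ⋆ H) w m       ≡⟨ ⋆-congʳ H FG≡δ w m ⟨
  ((F ⋆ G) ⋆ H) w m ≡⟨ ⋆-assoc F G H w m ⟩
  (F ⋆ (G ⋆ H)) w m ≡⟨ ⋆-congˡ F GH≡δ w m ⟩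
  (F ⋆ δ) w m       ≡⟨ ⋆-identityʳ F w m ⟩
  F w m             ∎
  where open ≡-Reasoning

-- Chains of sets and multisets: splitting off the smallest variable

-- The metavariable below is solved to the local function of maxSupp, which has no name in scope.
mutual
  maxSuppFrom : List ℕ → ℕ → ℕ → List ℕ → ℕ
  maxSuppFrom = _

  maxSupp-∷-maxSuppFrom : ∀ e es → maxSupp (e ∷ es) ≡ maxSuppFrom (e ∷ es) 1 (if e ≡ᵇ 0 then 0 else 0) es
  maxSupp-∷-maxSuppFrom e es with e ∷ es | 1 | if e ≡ᵇ 0 then 0 else 0
  ... | L | i | acc = refl

-- The loop behind `maxSupp` runs with an accumulator; this recursion peels off one variable, as the
-- induction on variables does. The zero vector gets 0, like a vector supported on the first
-- variable alone.
lastIndex : List ℕ → ℕ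
lastIndex []       = 0
lastIndex (e ∷ es) = if isZeroVec es then 0 else suc (lastIndex es)

maxSuppFrom-lastIndex : ∀ L i acc es →
  maxSuppFrom L i acc es ≡ (if isZeroVec es then acc else i ℕ.+ lastIndex es)
maxSuppFrom-lastIndex L i acc [] = refl
maxSuppFrom-lastIndex L i acc (zero ∷ es) rewrite maxSuppFrom-lastIndex L (suc i) acc es with isZeroVec es
... | true  = refl
... | false = sym (ℕ.+-suc i (lastIndex es))
maxSuppFrom-lastIndex L i acc (suc e ∷ es) rewrite maxSuppFrom-lastIndex L (suc i) i es with isZeroVec es
... | true  = sym (ℕ.+-identityʳ i)
... | false = sym (ℕ.+-suc i (lastIndex es))

maxSupp-lastIndex : ∀ es → maxSupp es ≡ lastIndex es
maxSupp-lastIndex [] = refl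
maxSupp-lastIndex (e ∷ es)
  rewrite maxSupp-∷-maxSuppFrom e es | maxSuppFrom-lastIndex (e ∷ es) 1 (if e ≡ᵇ 0 then 0 else 0) es
  with isZeroVec es | e
... | true  | zero  = refl
... | true  | suc _ = refl
... | false | _     = refl

maxSupp-∷ : ∀ a v → maxSupp (a ∷ v) ≡ (if isZeroVec v then 0 else suc (maxSupp v))
maxSupp-∷ a v rewrite maxSupp-lastIndex (a ∷ v) | maxSupp-lastIndex v = refl

link : Bool → List ℕ → List ℕ → Bool
link true  s t = maxSupp s <ᵇ minSupp t
link false s t = maxSupp s <ᵇ suc (minSupp t)

-- A value involving a later variable has positive maximum, while a value containing the first
-- variable has minimum 0.
link-nonzero-suc : ∀ d a b {v} u → isZeroVec v ≡ false → link d (a ∷ v) (suc b ∷ u) ≡ false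
link-nonzero-suc true  a b {v} u v≢0 = refl
link-nonzero-suc false a b {v} u v≢0 rewrite maxSupp-∷ a v | v≢0 = refl

link-nonzero-zero : ∀ d a {v} u → isZeroVec v ≡ false → link d (a ∷ v) (0 ∷ u) ≡ link d v u
link-nonzero-zero true  a {v} u v≢0 rewrite maxSupp-∷ a v | v≢0 = refl
link-nonzero-zero false a {v} u v≢0 rewrite maxSupp-∷ a v | v≢0 = refl

-- The maximum is 0, so a weak link always holds and a strict one says that the next value avoids
-- the first variable. For `a` equal to 0 the value is empty and the default of `maxSupp` gives the
-- same answer.
link-zero : ∀ d a b {v} u → isZeroVec v ≡ true → link d (a ∷ v) (b ∷ u) ≡ (if d then b ≡ᵇ 0 else true)
link-zero true  a zero    {v} u v≡0 rewrite maxSupp-∷ a v | v≡0 = refl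
link-zero true  a (suc b) {v} u v≡0 = refl
link-zero false a b       {v} u v≡0 rewrite maxSupp-∷ a v | v≡0 = refl

-- Nonemptiness and links, tested in separate passes by `ppCount`, are interleaved, so that removing
-- the first value strips its conditions off the front.
valid : List Bool → List (List ℕ) → Bool
valid ds       []          = true
valid ds       (s ∷ [])    = nonempty s
valid []       (s ∷ t ∷ σ) = nonempty s ∧ valid [] (t ∷ σ)
valid (d ∷ ds) (s ∷ t ∷ σ) = nonempty s ∧ (link d s t ∧ valid ds (t ∷ σ))

∧-shuffle : ∀ n a l c → (n ∧ a) ∧ (l ∧ c) ≡ n ∧ (l ∧ (a ∧ c))
∧-shuffle false a     l     c = refl
∧-shuffle true  true  l     c = refl
∧-shuffle true  false true  c = refl
∧-shuffle true  false false c = refl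

valid-correct : ∀ ds σ → foldr (λ s r → nonempty s ∧ r) true σ ∧ chainOK ds σ ≡ valid ds σ
valid-correct []       []          = refl
valid-correct (_ ∷ _)  []          = refl
valid-correct []       (s ∷ [])    = trans (∧-identityʳ _) (∧-identityʳ _)
valid-correct (_ ∷ _)  (s ∷ [])    = trans (∧-identityʳ _) (∧-identityʳ _)
valid-correct []       (s ∷ t ∷ σ) = trans (∧-assoc (nonempty s) _ true) (cong (nonempty s ∧_) (valid-correct [] (t ∷ σ)))
valid-correct (true ∷ ds) (s ∷ t ∷ σ) =
  trans (∧-shuffle (nonempty s) (foldr (λ s r → nonempty s ∧ r) true (t ∷ σ)) (link true s t) (chainOK ds (t ∷ σ)))
        (cong (λ b → nonempty s ∧ (link true s t ∧ b)) (valid-correct ds (t ∷ σ)))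
valid-correct (false ∷ ds) (s ∷ t ∷ σ) =
  trans (∧-shuffle (nonempty s) (foldr (λ s r → nonempty s ∧ r) true (t ∷ σ)) (link false s t) (chainOK ds (t ∷ σ)))
        (cong (λ b → nonempty s ∧ (link false s t ∧ b)) (valid-correct ds (t ∷ σ)))

-- An exponent vector with the first variable held apart: `proj₁` and `proj₂`, mapped over a chain,
-- give its parts in the first variable and in the others.
Split : Set
Split = ℕ × List ℕ

glue : Split → List ℕ
glue (a , v) = a ∷ v

allZero : List Split → Bool
allZero = all ((_≡ᵇ 0) ∘ proj₁)

swap∧ : ∀ a b c → a ∧ (b ∧ c) ≡ b ∧ (a ∧ c)
swap∧ true  b     c = refl
swap∧ false true  c = refl
swap∧ false false c = refl

-- A nonempty value avoiding the first variable has positive maximum, and the links pass this on to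
-- every later value.
valid-headZero : ∀ ds a v σ → length ds ≡ length σ →
  valid ds ((a ∷ v) ∷ map glue σ) ∧ (a ≡ᵇ 0) ≡ allZero ((a , v) ∷ σ) ∧ valid ds (v ∷ map proj₂ σ)
valid-headZero ds (suc a) v σ _ = ∧-zeroʳ _
valid-headZero [] zero v [] _ = ∧-identityʳ _
valid-headZero (d ∷ ds) zero v ((suc b , u) ∷ σ) eq with isZeroVec v in v≡
... | true  = refl
... | false = trans (∧-identityʳ _) (cong (_∧ valid ds ((suc b ∷ u) ∷ map glue σ)) (link-nonzero-suc d 0 b {v} u v≡))
valid-headZero (d ∷ ds) zero v ((zero , u) ∷ σ) eq with isZeroVec v in v≡
... | true  = sym (∧-zeroʳ _)
... | false = begin
  (link d (0 ∷ v) (0 ∷ u) ∧ valid ds ((0 ∷ u) ∷ map glue σ)) ∧ true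
    ≡⟨ ∧-assoc (link d (0 ∷ v) (0 ∷ u)) _ true ⟩
  link d (0 ∷ v) (0 ∷ u) ∧ (valid ds ((0 ∷ u) ∷ map glue σ) ∧ true)
    ≡⟨ cong₂ _∧_ (link-nonzero-zero d 0 {v} u v≡) (valid-headZero ds 0 u σ (ℕ.suc-injective eq)) ⟩
  link d v u ∧ (allZero σ ∧ valid ds (u ∷ map proj₂ σ))
    ≡⟨ swap∧ (link d v u) (allZero σ) _ ⟩
  allZero σ ∧ (link d v u ∧ valid ds (u ∷ map proj₂ σ)) ∎
  where open ≡-Reasoning

-- With an arbitrary relation in place of the order on letters, complementing descents changes `r`
-- and leaves the letters alone.
des : (A → A → Bool) → List A → List Bool
des r []          = []
des r (x ∷ [])    = []
des r (x ∷ y ∷ w) = r x y ∷ des r (y ∷ w)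

length-des : ∀ (r : A → A → Bool) x w → length (des r (x ∷ w)) ≡ length w
length-des r x []      = refl
length-des r x (y ∷ w) = cong suc (length-des r y w)

startsWithDescent : (A → A → Bool) → A → List A → Bool
startsWithDescent r x []      = false
startsWithDescent r x (y ∷ w) = r x y

-- A value a ∷ v of σ containing the first variable and another one forces all later values
-- to avoid the first variable; a value that is a power of the first variable leaves the
-- rest free up to its link with the next value.
⟦valid⟧-∷ : ∀ (r : A → A → Bool) x w a v σ → length σ ≡ length w →
  ⟦ valid (des r (x ∷ w)) ((a ∷ v) ∷ map glue σ) ⟧ ≡
  ⟦ allZero σ ⟧ * ⟦ valid (des r (x ∷ w)) (v ∷ map proj₂ σ) ⟧ +
  ⟦ not (a ≡ᵇ 0) ⟧ * ⟦ isZeroVec v ⟧ *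
    (if startsWithDescent r x w then ⟦ allZero σ ⟧ * ⟦ valid (des r w) (map proj₂ σ) ⟧
                                else ⟦ valid (des r w) (map glue σ) ⟧)
⟦valid⟧-∷ r x [] zero    v [] _ with isZeroVec v
... | true  = refl
... | false = refl
⟦valid⟧-∷ r x [] (suc a) v [] _ with isZeroVec v
... | true  = refl
... | false = refl
⟦valid⟧-∷ r x (y ∷ w) a v ((b , u) ∷ σ) eq with isZeroVec v in v≡
... | true = isZero a (r x y)
  where
  len : length (des r (y ∷ w)) ≡ length σ
  len = trans (length-des r y w) (sym (ℕ.suc-injective eq))
  isZero : ∀ a d →
    ⟦ not ((a ≡ᵇ 0) ∧ true) ∧ (link d (a ∷ v) (b ∷ u) ∧ valid (des r (y ∷ w)) ((b ∷ u) ∷ map glue σ)) ⟧ ≡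
    ⟦ allZero ((b , u) ∷ σ) ⟧ * 0ℤ +
    ⟦ not (a ≡ᵇ 0) ⟧ * 1ℤ *
      (if d then ⟦ allZero ((b , u) ∷ σ) ⟧ * ⟦ valid (des r (y ∷ w)) (u ∷ map proj₂ σ) ⟧
            else ⟦ valid (des r (y ∷ w)) ((b ∷ u) ∷ map glue σ) ⟧)
  -- The value `a ∷ v` is empty here, so both sides vanish.
  isZero zero    d     = sym (0s ⟦ allZero ((b , u) ∷ σ) ⟧ (if d then ⟦ allZero ((b , u) ∷ σ) ⟧ * ⟦ valid (des r (y ∷ w)) (u ∷ map proj₂ σ) ⟧ else ⟦ valid (des r (y ∷ w)) ((b ∷ u) ∷ map glue σ) ⟧))
    where
    0s : ∀ a c → a * 0ℤ + 0ℤ * 1ℤ * c ≡ 0ℤ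
    0s = solve-∀
  isZero (suc a) true  rewrite link-zero true (suc a) b {v} u v≡ = begin
    ⟦ (b ≡ᵇ 0) ∧ valid (des r (y ∷ w)) ((b ∷ u) ∷ map glue σ) ⟧
      ≡⟨ cong ⟦_⟧ (trans (∧-comm (b ≡ᵇ 0) _) (valid-headZero (des r (y ∷ w)) b u σ len)) ⟩
    ⟦ allZero ((b , u) ∷ σ) ∧ valid (des r (y ∷ w)) (u ∷ map proj₂ σ) ⟧
      ≡⟨ ⟦∧⟧ (allZero ((b , u) ∷ σ)) _ ⟩
    ⟦ allZero ((b , u) ∷ σ) ⟧ * ⟦ valid (des r (y ∷ w)) (u ∷ map proj₂ σ) ⟧
      ≡⟨ pad ⟦ allZero ((b , u) ∷ σ) ⟧ _ ⟨
    ⟦ allZero ((b , u) ∷ σ) ⟧ * 0ℤ + 1ℤ * 1ℤ * (⟦ allZero ((b , u) ∷ σ) ⟧ * ⟦ valid (des r (y ∷ w)) (u ∷ map proj₂ σ) ⟧) ∎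
    where
    open ≡-Reasoning
    pad : ∀ a c → a * 0ℤ + 1ℤ * 1ℤ * c ≡ c
    pad = solve-∀
  isZero (suc a) false rewrite link-zero false (suc a) b {v} u v≡ = sym (pad ⟦ allZero ((b , u) ∷ σ) ⟧ _)
    where
    pad : ∀ a c → a * 0ℤ + 1ℤ * 1ℤ * c ≡ c
    pad = solve-∀
... | false = begin
  ⟦ not ((a ≡ᵇ 0) ∧ false) ∧ (link (r x y) (a ∷ v) (b ∷ u) ∧ valid (des r (y ∷ w)) ((b ∷ u) ∷ map glue σ)) ⟧
    ≡⟨ cong ⟦_⟧ (isNonzero a b) ⟩
  ⟦ allZero ((b , u) ∷ σ) ∧ (link (r x y) v u ∧ valid (des r (y ∷ w)) (u ∷ map proj₂ σ)) ⟧
    ≡⟨ ⟦∧⟧ (allZero ((b , u) ∷ σ)) _ ⟩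
  ⟦ allZero ((b , u) ∷ σ) ⟧ * ⟦ link (r x y) v u ∧ valid (des r (y ∷ w)) (u ∷ map proj₂ σ) ⟧
    ≡⟨ pad _ ⟦ not (a ≡ᵇ 0) ⟧ _ ⟨
  ⟦ allZero ((b , u) ∷ σ) ⟧ * ⟦ link (r x y) v u ∧ valid (des r (y ∷ w)) (u ∷ map proj₂ σ) ⟧ + ⟦ not (a ≡ᵇ 0) ⟧ * 0ℤ * rest ∎
  where
  open ≡-Reasoning
  rest = if r x y then ⟦ allZero ((b , u) ∷ σ) ⟧ * ⟦ valid (des r (y ∷ w)) (u ∷ map proj₂ σ) ⟧
                  else ⟦ valid (des r (y ∷ w)) ((b ∷ u) ∷ map glue σ) ⟧
  pad : ∀ a b c → a + b * 0ℤ * c ≡ a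
  pad = solve-∀
  len : length (des r (y ∷ w)) ≡ length σ
  len = trans (length-des r y w) (sym (ℕ.suc-injective eq))
  isNonzero : ∀ a b →
    not ((a ≡ᵇ 0) ∧ false) ∧ (link (r x y) (a ∷ v) (b ∷ u) ∧ valid (des r (y ∷ w)) ((b ∷ u) ∷ map glue σ)) ≡
    allZero ((b , u) ∷ σ) ∧ (link (r x y) v u ∧ valid (des r (y ∷ w)) (u ∷ map proj₂ σ))
  isNonzero a (suc b) rewrite ∧-zeroʳ (a ≡ᵇ 0) | link-nonzero-suc (r x y) a b {v} u v≡ = refl
  isNonzero a zero    rewrite ∧-zeroʳ (a ≡ᵇ 0) | link-nonzero-zero (r x y) a {v} u v≡ = begin
    link (r x y) v u ∧ valid (des r (y ∷ w)) ((0 ∷ u) ∷ map glue σ)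
      ≡⟨ cong (link (r x y) v u ∧_) (trans (sym (∧-identityʳ _)) (valid-headZero (des r (y ∷ w)) 0 u σ len)) ⟩
    link (r x y) v u ∧ (allZero σ ∧ valid (des r (y ∷ w)) (u ∷ map proj₂ σ))
      ≡⟨ swap∧ (link (r x y) v u) (allZero σ) _ ⟩
    allZero σ ∧ (link (r x y) v u ∧ valid (des r (y ∷ w)) (u ∷ map proj₂ σ)) ∎

-- Sums over tuples of exponent vectors.

∑-tuples-suc : ∀ n (xs : List A) (f : List A → ℤ) →
  ∑ (tuples (suc n) xs) f ≡ ∑ (tuples n xs) (λ t → ∑ xs (λ x → f (x ∷ t)))
∑-tuples-suc n xs f = trans (∑-concatMap _ (tuples n xs) f) (∑-cong (tuples n xs) (λ t → ∑-map (_∷ t) xs f))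

∑-tuples-map : ∀ n (g : A → B) xs (f : List B → ℤ) →
  ∑ (tuples n (map g xs)) f ≡ ∑ (tuples n xs) (f ∘ map g)
∑-tuples-map zero    g xs f = refl
∑-tuples-map (suc n) g xs f = begin
  ∑ (tuples (suc n) (map g xs)) f
    ≡⟨ ∑-tuples-suc n (map g xs) f ⟩
  ∑ (tuples n (map g xs)) (λ t → ∑ (map g xs) (λ x → f (x ∷ t)))
    ≡⟨ ∑-tuples-map n g xs _ ⟩
  ∑ (tuples n xs) (λ t → ∑ (map g xs) (λ x → f (x ∷ map g t)))
    ≡⟨ ∑-cong (tuples n xs) (λ t → ∑-map g xs _) ⟩
  ∑ (tuples n xs) (λ t → ∑ xs (λ x → f (map g (x ∷ t))))
    ≡⟨ ∑-tuples-suc n xs (f ∘ map g) ⟨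
  ∑ (tuples (suc n) xs) (f ∘ map g) ∎
  where open ≡-Reasoning

-- Makes the length of each tuple available, on which `⟦valid⟧-∷` depends.
∑-tuples-cong : ∀ n (xs : List A) {f g : List A → ℤ} → (∀ t → length t ≡ n → f t ≡ g t) →
  ∑ (tuples n xs) f ≡ ∑ (tuples n xs) g
∑-tuples-cong zero    xs f≡g = cong (_+ 0ℤ) (f≡g [] refl)
∑-tuples-cong (suc n) xs {f} {g} f≡g =
  trans (∑-tuples-suc n xs f)
    (trans (∑-tuples-cong n xs (λ t eq → ∑-cong xs (λ x → f≡g (x ∷ t) (cong suc eq))))
      (sym (∑-tuples-suc n xs g)))

splitBoxes : ℕ → List ℕ → List Split
splitBoxes b bs = concatMap (λ v → map (_, v) (upTo (suc b))) (boxes bs)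

map-glue-splitBoxes : ∀ b bs → map glue (splitBoxes b bs) ≡ boxes (b ∷ bs)
map-glue-splitBoxes b bs =
  trans (map-concatMap glue _ (boxes bs)) (concatMap-cong (λ v → sym (map-∘ (upTo (suc b)))) (boxes bs))

∑-splitBoxes : ∀ b bs (f : ℕ → List ℕ → ℤ) →
  ∑₂ (splitBoxes b bs) f ≡ ∑ (boxes bs) (λ v → ∑ (upTo (suc b)) (λ a → f a v))
∑-splitBoxes b bs f = trans (∑-concatMap _ (boxes bs) _) (∑-cong (boxes bs) (λ v → ∑-map (_, v) (upTo (suc b)) (uncurry f)))

∑-boxes-∷ : ∀ b bs (f : List ℕ → ℤ) →
  ∑ (boxes (b ∷ bs)) f ≡ ∑ (boxes bs) (λ v → ∑ (upTo (suc b)) (λ a → f (a ∷ v)))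
∑-boxes-∷ b bs f = trans (∑-concatMap _ (boxes bs) f) (∑-cong (boxes bs) (λ v → ∑-map _ (upTo (suc b)) f))

∑-upTo-suc : ∀ b (f : ℕ → ℤ) → ∑ (upTo (suc b)) f ≡ f 0 + ∑ (upTo b) (f ∘ suc)
∑-upTo-suc b f = cong (f 0 +_) (trans (cong (λ l → ∑ l f) (sym (map-upTo suc b))) (∑-map suc (upTo b) f))

∑-upTo-nonzero : ∀ b (f : ℕ → ℤ) →
  ∑ (upTo (suc b)) (λ a → ⟦ not (a ≡ᵇ 0) ⟧ * f a) ≡ ∑ (upTo b) (f ∘ suc)
∑-upTo-nonzero b f =
  trans (∑-upTo-suc b (λ a → ⟦ not (a ≡ᵇ 0) ⟧ * f a))
    (trans (+-identityˡ _) (∑-cong (upTo b) (λ i → *-identityˡ (f (suc i)))))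

∑-upTo-zero : ∀ b (f : ℕ → ℤ) → ∑ (upTo (suc b)) (λ a → ⟦ a ≡ᵇ 0 ⟧ * f a) ≡ f 0
∑-upTo-zero b f =
  trans (∑-upTo-suc b (λ a → ⟦ a ≡ᵇ 0 ⟧ * f a))
    (trans (cong (1ℤ * f 0 +_) (∑-zero (upTo b) (λ _ → refl))) (1*a+0 (f 0)))

∑-boxes-zero : ∀ bs (f : List ℕ → ℤ) →
  ∑ (boxes bs) (λ v → ⟦ isZeroVec v ⟧ * f v) ≡ f (replicate (length bs) 0)
∑-boxes-zero []       f = 1*a+0 (f [])
∑-boxes-zero (b ∷ bs) f = begin
  ∑ (boxes (b ∷ bs)) (λ v → ⟦ isZeroVec v ⟧ * f v)
    ≡⟨ ∑-boxes-∷ b bs _ ⟩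
  ∑ (boxes bs) (λ v → ∑ (upTo (suc b)) (λ a → ⟦ (a ≡ᵇ 0) ∧ isZeroVec v ⟧ * f (a ∷ v)))
    ≡⟨ ∑-cong (boxes bs) (λ v → trans
         (∑-cong (upTo (suc b)) (λ a → trans (cong (_* f (a ∷ v)) (⟦∧⟧ (a ≡ᵇ 0) (isZeroVec v))) (*-assoc ⟦ a ≡ᵇ 0 ⟧ _ _)))
         (∑-upTo-zero b (λ a → ⟦ isZeroVec v ⟧ * f (a ∷ v)))) ⟩
  ∑ (boxes bs) (λ v → ⟦ isZeroVec v ⟧ * f (0 ∷ v))
    ≡⟨ ∑-boxes-zero bs (f ∘ (0 ∷_)) ⟩
  f (replicate (length (b ∷ bs)) 0) ∎
  where open ≡-Reasoning

-- The exponent 0 occurs exactly once in each range, so chains avoiding the first variable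
-- correspond to chains in the others.
∑-allZero : ∀ n b bs (h : List (List ℕ) → ℤ) →
  ∑ (tuples n (splitBoxes b bs)) (λ σ → ⟦ allZero σ ⟧ * h (map proj₂ σ)) ≡ ∑ (tuples n (boxes bs)) h
∑-allZero zero    b bs h = trans (1*a+0 (h [])) (sym (+-identityʳ (h [])))
∑-allZero (suc n) b bs h = begin
  ∑ (tuples (suc n) (splitBoxes b bs)) (λ σ → ⟦ allZero σ ⟧ * h (map proj₂ σ))
    ≡⟨ ∑-tuples-suc n (splitBoxes b bs) _ ⟩
  ∑ (tuples n (splitBoxes b bs)) (λ σ → ∑₂ (splitBoxes b bs) (λ a v → ⟦ (a ≡ᵇ 0) ∧ allZero σ ⟧ * h (v ∷ map proj₂ σ)))
    ≡⟨ ∑-cong (tuples n (splitBoxes b bs)) (λ σ → trans (∑-splitBoxes b bs _) (trans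
         (∑-cong (boxes bs) (λ v → trans
           (∑-cong (upTo (suc b)) (λ a → trans (cong (_* h (v ∷ map proj₂ σ)) (⟦∧⟧ (a ≡ᵇ 0) (allZero σ))) (*-assoc ⟦ a ≡ᵇ 0 ⟧ _ _)))
           (∑-upTo-zero b (λ a → ⟦ allZero σ ⟧ * h (v ∷ map proj₂ σ)))))
         (sym (∑-*ˡ (boxes bs) ⟦ allZero σ ⟧ _)))) ⟩
  ∑ (tuples n (splitBoxes b bs)) (λ σ → ⟦ allZero σ ⟧ * ∑ (boxes bs) (λ v → h (v ∷ map proj₂ σ)))
    ≡⟨ ∑-allZero n b bs (λ t → ∑ (boxes bs) (λ v → h (v ∷ t))) ⟩
  ∑ (tuples n (boxes bs)) (λ t → ∑ (boxes bs) (λ v → h (v ∷ t)))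
    ≡⟨ ∑-tuples-suc n (boxes bs) h ⟨
  ∑ (tuples (suc n) (boxes bs)) h ∎
  where open ≡-Reasoning

allZero-sum : ∀ (φ : ℕ → ℤ) a σ → ⟦ allZero σ ⟧ * φ (a ℕ.+ sum (map proj₁ σ)) ≡ ⟦ allZero σ ⟧ * φ a
allZero-sum φ a []                = cong (λ s → 1ℤ * φ s) (ℕ.+-identityʳ a)
allZero-sum φ a ((zero  , _) ∷ σ) = allZero-sum φ a σ
allZero-sum φ a ((suc _ , _) ∷ σ) = refl

-- `zipWith` truncates to the shorter list, so adding a zero vector preserves only vectors that are
-- not longer; this bound supplies that.
length-vsumAll : ∀ k t → length (vsumAll k t) ≤ k
length-vsumAll k []      = ℕ.≤-reflexive (length-replicate k)
length-vsumAll k (v ∷ t) =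
  ℕ.≤-trans (ℕ.≤-reflexive (length-zipWith ℕ._+_ v (vsumAll k t)))
    (ℕ.≤-trans (ℕ.m⊓n≤n (length v) _) (length-vsumAll k t))

zipWith-+-zeroˡ : ∀ k u → length u ≤ k → zipWith ℕ._+_ (replicate k 0) u ≡ u
zipWith-+-zeroˡ zero    []      _       = refl
zipWith-+-zeroˡ (suc k) []      _       = refl
zipWith-+-zeroˡ (suc k) (a ∷ u) (s≤s p) = cong (a ∷_) (zipWith-+-zeroˡ k u p)

-- Chains of prescribed weight: removal of the first value.

module _ (r : A → A → Bool) (bs m : List ℕ) where

  hasWeight : List (List ℕ) → ℤ
  hasWeight t = ⟦ eqVec (vsumAll (length bs) t) m ⟧

  -- `bs` bounds the multiplicities and `m` is the exponent sought. All ones in `bs` give sets and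
  -- `bs` equal to `m` gives multisets, so one recursion serves both series.
  chains : List A → ℤ
  chains w = ∑ (tuples (length w) (boxes bs)) (λ t → ⟦ valid (des r w) t ⟧ * hasWeight t)

  module _ (b : ℕ) where

    -- The total exponent of the first variable is weighted by an arbitrary φ instead of being required
    -- to equal a given exponent, so that removing a value only shifts φ and subtracts nothing.
    chains⁺ : List A → (ℕ → ℤ) → ℤ
    chains⁺ w φ = ∑ (tuples (length w) (splitBoxes b bs))
      (λ σ → ⟦ valid (des r w) (map glue σ) ⟧ * (φ (sum (map proj₁ σ)) * hasWeight (map proj₂ σ)))

    rest : A → List A → List Split → ℤ
    rest x w σ = if startsWithDescent r x w then ⟦ allZero σ ⟧ * ⟦ valid (des r w) (map proj₂ σ) ⟧
                                            else ⟦ valid (des r w) (map glue σ) ⟧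

    -- Either the first value contains a later variable, and then its exponent in the first variable
    -- is free from 0 to `b` while all later values avoid that variable; or it is a power `suc i` of
    -- the first variable alone.
    ∑-firstValue : ∀ x w (φ : ℕ → ℤ) σ → length σ ≡ length w →
      ∑₂ (splitBoxes b bs) (λ a v → ⟦ valid (des r (x ∷ w)) ((a ∷ v) ∷ map glue σ) ⟧ *
                                    (φ (a ℕ.+ sum (map proj₁ σ)) * hasWeight (v ∷ map proj₂ σ))) ≡
      ⟦ allZero σ ⟧ * (∑ (upTo (suc b)) φ *
        ∑ (boxes bs) (λ v → ⟦ valid (des r (x ∷ w)) (v ∷ map proj₂ σ) ⟧ * hasWeight (v ∷ map proj₂ σ))) +
      ∑ (upTo b) (λ i → hasWeight (map proj₂ σ) * (rest x w σ * φ (suc i ℕ.+ sum (map proj₁ σ))))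
    ∑-firstValue x w φ σ len = begin
      ∑₂ (splitBoxes b bs) (λ a v → ⟦ valid (des r (x ∷ w)) ((a ∷ v) ∷ map glue σ) ⟧ * (φ (a ℕ.+ s) * E v))
        ≡⟨ ∑-splitBoxes b bs _ ⟩
      ∑ (boxes bs) (λ v → ∑ (upTo (suc b)) (λ a → ⟦ valid (des r (x ∷ w)) ((a ∷ v) ∷ map glue σ) ⟧ * (φ (a ℕ.+ s) * E v)))
        ≡⟨ ∑-cong (boxes bs) (λ v → trans (∑-cong (upTo (suc b)) (pointwise v)) (trans (∑-+ (upTo (suc b)) (λ a → X * (Y v * E v) * φ a) _)
             (cong₂ _+_ (sym (∑-*ˡ (upTo (suc b)) (X * (Y v * E v)) φ))
               (trans (sym (∑-*ˡ (upTo (suc b)) (⟦ isZeroVec v ⟧ * E v) (λ a → ⟦ not (a ≡ᵇ 0) ⟧ * (R * φ (a ℕ.+ s))))) (cong (⟦ isZeroVec v ⟧ * E v *_) (∑-upTo-nonzero b (λ a → R * φ (a ℕ.+ s)))))))) ⟩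
      ∑ (boxes bs) (λ v → X * (Y v * E v) * Φ + ⟦ isZeroVec v ⟧ * E v * K)
        ≡⟨ ∑-+ (boxes bs) _ _ ⟩
      ∑ (boxes bs) (λ v → X * (Y v * E v) * Φ) + ∑ (boxes bs) (λ v → ⟦ isZeroVec v ⟧ * E v * K)
        ≡⟨ cong₂ _+_ first second ⟩
      X * (Φ * ∑ (boxes bs) (λ v → Y v * E v)) + ∑ (upTo b) (λ i → hasWeight (map proj₂ σ) * (R * φ (suc i ℕ.+ s))) ∎
      where
      open ≡-Reasoning
      s = sum (map proj₁ σ)
      X = ⟦ allZero σ ⟧
      Φ = ∑ (upTo (suc b)) φ
      R = rest x w σ
      K = ∑ (upTo b) (λ i → R * φ (suc i ℕ.+ s))
      Y E : List ℕ → ℤ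
      Y v = ⟦ valid (des r (x ∷ w)) (v ∷ map proj₂ σ) ⟧
      E v = hasWeight (v ∷ map proj₂ σ)
      expand : ∀ X Y n z R p E → (X * Y + n * z * R) * (p * E) ≡ (Y * E) * (X * p) + z * E * (n * (R * p))
      expand = solve-∀
      reorder : ∀ X Y E q → (Y * E) * (X * q) ≡ X * (Y * E) * q
      reorder = solve-∀
      pointwise : ∀ v a → ⟦ valid (des r (x ∷ w)) ((a ∷ v) ∷ map glue σ) ⟧ * (φ (a ℕ.+ s) * E v) ≡
                  X * (Y v * E v) * φ a + ⟦ isZeroVec v ⟧ * E v * (⟦ not (a ≡ᵇ 0) ⟧ * (R * φ (a ℕ.+ s)))
      pointwise v a = begin
        ⟦ valid (des r (x ∷ w)) ((a ∷ v) ∷ map glue σ) ⟧ * (φ (a ℕ.+ s) * E v)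
          ≡⟨ cong (_* (φ (a ℕ.+ s) * E v)) (⟦valid⟧-∷ r x w a v σ len) ⟩
        (X * Y v + ⟦ not (a ≡ᵇ 0) ⟧ * ⟦ isZeroVec v ⟧ * R) * (φ (a ℕ.+ s) * E v)
          ≡⟨ expand X (Y v) ⟦ not (a ≡ᵇ 0) ⟧ ⟦ isZeroVec v ⟧ R (φ (a ℕ.+ s)) (E v) ⟩
        (Y v * E v) * (X * φ (a ℕ.+ s)) + ⟦ isZeroVec v ⟧ * E v * (⟦ not (a ≡ᵇ 0) ⟧ * (R * φ (a ℕ.+ s)))
          ≡⟨ cong (_+ ⟦ isZeroVec v ⟧ * E v * (⟦ not (a ≡ᵇ 0) ⟧ * (R * φ (a ℕ.+ s))))
               (trans (cong ((Y v * E v) *_) (allZero-sum φ a σ)) (reorder X (Y v) (E v) (φ a))) ⟩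
        X * (Y v * E v) * φ a + ⟦ isZeroVec v ⟧ * E v * (⟦ not (a ≡ᵇ 0) ⟧ * (R * φ (a ℕ.+ s))) ∎
      first : ∑ (boxes bs) (λ v → X * (Y v * E v) * Φ) ≡ X * (Φ * ∑ (boxes bs) (λ v → Y v * E v))
      first = begin
        ∑ (boxes bs) (λ v → X * (Y v * E v) * Φ) ≡⟨ ∑-*ʳ (boxes bs) _ Φ ⟨
        ∑ (boxes bs) (λ v → X * (Y v * E v)) * Φ ≡⟨ cong (_* Φ) (∑-*ˡ (boxes bs) X _) ⟨
        X * S * Φ                                 ≡⟨ *-assoc X S Φ ⟩
        X * (S * Φ)                               ≡⟨ cong (X *_) (*-comm S Φ) ⟩
        X * (Φ * S)                               ∎
        where S = ∑ (boxes bs) (λ v → Y v * E v)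
      second : ∑ (boxes bs) (λ v → ⟦ isZeroVec v ⟧ * E v * K) ≡ ∑ (upTo b) (λ i → hasWeight (map proj₂ σ) * (R * φ (suc i ℕ.+ s)))
      second = begin
        ∑ (boxes bs) (λ v → ⟦ isZeroVec v ⟧ * E v * K)   ≡⟨ ∑-cong (boxes bs) (λ v → *-assoc ⟦ isZeroVec v ⟧ (E v) K) ⟩
        ∑ (boxes bs) (λ v → ⟦ isZeroVec v ⟧ * (E v * K)) ≡⟨ ∑-boxes-zero bs (λ v → E v * K) ⟩
        E (replicate (length bs) 0) * K
          ≡⟨ cong (λ u → ⟦ eqVec u m ⟧ * K) (zipWith-+-zeroˡ (length bs) _ (length-vsumAll (length bs) (map proj₂ σ))) ⟩
        hasWeight (map proj₂ σ) * K
          ≡⟨ ∑-*ˡ (upTo b) (hasWeight (map proj₂ σ)) (λ i → R * φ (suc i ℕ.+ s)) ⟩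
        ∑ (upTo b) (λ i → hasWeight (map proj₂ σ) * (R * φ (suc i ℕ.+ s))) ∎

    -- After a pure power, a strict link expels the first variable from the rest, whose total
    -- exponent is then `suc i`; a weak link leaves the same problem for `w` with `φ` shifted.
    ∑-rest : ∀ x w (φ : ℕ → ℤ) i →
      ∑ (tuples (length w) (splitBoxes b bs)) (λ σ → hasWeight (map proj₂ σ) * (rest x w σ * φ (suc i ℕ.+ sum (map proj₁ σ)))) ≡
      (if startsWithDescent r x w then φ (suc i) * chains w else chains⁺ w (φ ∘ (suc i ℕ.+_)))
    ∑-rest x w φ i with startsWithDescent r x w
    ... | false = ∑-cong (tuples (length w) (splitBoxes b bs)) (λ σ →
          rot (hasWeight (map proj₂ σ)) ⟦ valid (des r w) (map glue σ) ⟧ (φ (suc i ℕ.+ sum (map proj₁ σ))))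
      where
      rot : ∀ a b c → a * (b * c) ≡ b * (c * a)
      rot = solve-∀
    ... | true = begin
      ∑ σs (λ σ → hasWeight (map proj₂ σ) * (⟦ allZero σ ⟧ * V (map proj₂ σ) * φ (suc i ℕ.+ sum (map proj₁ σ))))
        ≡⟨ ∑-cong σs (λ σ → trans (pull (hasWeight (map proj₂ σ)) ⟦ allZero σ ⟧ (V (map proj₂ σ)) (φ (suc i ℕ.+ sum (map proj₁ σ))))
             (trans (cong (V (map proj₂ σ) * hasWeight (map proj₂ σ) *_) (allZero-sum φ (suc i) σ))
                    (push (V (map proj₂ σ) * hasWeight (map proj₂ σ)) ⟦ allZero σ ⟧ (φ (suc i))))) ⟩
      ∑ σs (λ σ → ⟦ allZero σ ⟧ * (φ (suc i) * (V (map proj₂ σ) * hasWeight (map proj₂ σ))))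
        ≡⟨ ∑-allZero (length w) b bs (λ t → φ (suc i) * (V t * hasWeight t)) ⟩
      ∑ (tuples (length w) (boxes bs)) (λ t → φ (suc i) * (V t * hasWeight t))
        ≡⟨ ∑-*ˡ (tuples (length w) (boxes bs)) (φ (suc i)) _ ⟨
      φ (suc i) * chains w ∎
      where
      open ≡-Reasoning
      σs = tuples (length w) (splitBoxes b bs)
      V : List (List ℕ) → ℤ
      V t = ⟦ valid (des r w) t ⟧
      pull : ∀ e x v p → e * (x * v * p) ≡ v * e * (x * p)
      pull = solve-∀
      push : ∀ ve x p → ve * (x * p) ≡ x * (p * ve)
      push = solve-∀

    chains⁺-∷ : ∀ x w (φ : ℕ → ℤ) →
      chains⁺ (x ∷ w) φ ≡
      ∑ (upTo (suc b)) φ * chains (x ∷ w) +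
      ∑ (upTo b) (λ i → if startsWithDescent r x w then φ (suc i) * chains w else chains⁺ w (φ ∘ (suc i ℕ.+_)))
    chains⁺-∷ x w φ = begin
      chains⁺ (x ∷ w) φ
        ≡⟨ ∑-tuples-suc n (splitBoxes b bs) _ ⟩
      ∑ σs (λ σ → ∑₂ (splitBoxes b bs) (λ a v → ⟦ valid (des r (x ∷ w)) ((a ∷ v) ∷ map glue σ) ⟧ *
                                    (φ (a ℕ.+ sum (map proj₁ σ)) * hasWeight (v ∷ map proj₂ σ))))
        ≡⟨ ∑-tuples-cong n (splitBoxes b bs) (∑-firstValue x w φ) ⟩
      ∑ σs (λ σ → ⟦ allZero σ ⟧ * (Φ * h (map proj₂ σ)) + ∑ (upTo b) (g σ))
        ≡⟨ ∑-+ σs _ _ ⟩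
      ∑ σs (λ σ → ⟦ allZero σ ⟧ * (Φ * h (map proj₂ σ))) + ∑ σs (λ σ → ∑ (upTo b) (g σ))
        ≡⟨ cong₂ _+_ (∑-allZero n b bs (λ t → Φ * h t)) (∑-swap σs (upTo b) g) ⟩
      ∑ (tuples n (boxes bs)) (λ t → Φ * h t) + ∑ (upTo b) (λ i → ∑ σs (λ σ → g σ i))
        ≡⟨ cong₂ _+_ (trans (sym (∑-*ˡ (tuples n (boxes bs)) Φ h)) (cong (Φ *_) (sym (∑-tuples-suc n (boxes bs) _))))
                     (∑-cong (upTo b) (∑-rest x w φ)) ⟩
      Φ * chains (x ∷ w) +
      ∑ (upTo b) (λ i → if startsWithDescent r x w then φ (suc i) * chains w else chains⁺ w (φ ∘ (suc i ℕ.+_))) ∎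
      where
      open ≡-Reasoning
      n = length w
      σs = tuples n (splitBoxes b bs)
      Φ = ∑ (upTo (suc b)) φ
      h : List (List ℕ) → ℤ
      h t = ∑ (boxes bs) (λ v → ⟦ valid (des r (x ∷ w)) (v ∷ t) ⟧ * hasWeight (v ∷ t))
      g : List Split → ℕ → ℤ
      g σ i = hasWeight (map proj₂ σ) * (rest x w σ * φ (suc i ℕ.+ sum (map proj₁ σ)))

-- A first factor is empty or begins with `x`; knowing the letter lets `des` reduce in the second
-- case.
wordCuts-cong-∷ : ∀ (x : A) w (φ ψ : List A → List A → ℤ) → φ [] (x ∷ w) ≡ ψ [] (x ∷ w) →
  (∀ u u′ → φ (x ∷ u) u′ ≡ ψ (x ∷ u) u′) → ∑₂ (wordCuts (x ∷ w)) φ ≡ ∑₂ (wordCuts (x ∷ w)) ψ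
wordCuts-cong-∷ x w φ ψ eq[] eq∷ =
  trans (∑-wordCuts-∷ x w φ)
    (trans (cong₂ _+_ eq[] (cong₂ _+_ (eq∷ [] (x ∷ w)) (∑₂-cong (wordCuts w) eq∷)))
      (sym (∑-wordCuts-∷ x w ψ)))

-- The smallest variable as the first factor of a cut.

ascending : (A → A → Bool) → List A → Bool
ascending r u = all not (des r u)

-- With `φ` the indicator of `e`, this is the coefficient of xᵉ in (x + ⋯ + xᵇ)ˡ.
weight : ℕ → ℕ → (ℕ → ℤ) → ℤ
weight b zero    φ = φ 0
weight b (suc l) φ = ∑ (upTo b) (λ i → weight b l (φ ∘ (suc i ℕ.+_)))

module _ (r : A → A → Bool) (bs m : List ℕ) (b : ℕ) where

  private
    cutTerm : (ℕ → ℤ) → List A → List A → ℤ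
    cutTerm φ u u′ = ⟦ ascending r u ⟧ * weight b (length u) φ * chains r bs m u′

    cutTerm-∷ : A → (ℕ → ℤ) → List A → List A → ℤ
    cutTerm-∷ x φ u u′ = ⟦ ascending r (x ∷ u) ⟧ * weight b (suc (length u)) φ * chains r bs m u′

    ∑-cutTerm : ∀ w (φ : ℕ → ℤ) →
      ∑ (upTo b) (λ i → ∑₂ (wordCuts w) (cutTerm (φ ∘ (suc i ℕ.+_)))) ≡
      ∑₂ (wordCuts w) (λ u u′ → ⟦ ascending r u ⟧ * weight b (suc (length u)) φ * chains r bs m u′)
    ∑-cutTerm w φ = trans (∑-swap (upTo b) (wordCuts w) (λ i (u , u′) → cutTerm (φ ∘ (suc i ℕ.+_)) u u′))
      (∑₂-cong (wordCuts w) (λ u u′ → trans (sym (∑-*ʳ (upTo b) (λ i → ⟦ ascending r u ⟧ * weight b (length u) (φ ∘ (suc i ℕ.+_))) (chains r bs m u′)))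
        (cong (_* chains r bs m u′) (sym (∑-*ˡ (upTo b) ⟦ ascending r u ⟧ _)))))

    ∑-first : ∀ (φ : ℕ → ℤ) → ∑ (upTo b) (λ i → φ (suc i ℕ.+ 0)) ≡ ∑ (upTo b) (φ ∘ suc)
    ∑-first φ = ∑-cong (upTo b) (λ i → cong (φ ∘ suc) (ℕ.+-identityʳ i))

    -- Without a descent from `x` to `y`, prepending `x` to the first factor keeps it ascending or
    -- not, as it was. With one, only the empty first factor survives the prepending.
    ∑-remaining-∷ : ∀ x y w (φ : ℕ → ℤ) → (∀ ψ → chains⁺ r bs m b (y ∷ w) ψ ≡ ∑₂ (wordCuts (y ∷ w)) (cutTerm ψ)) →
      ∀ d → r x y ≡ d →
      ∑ (upTo b) (λ i → if d then φ (suc i) * chains r bs m (y ∷ w) else chains⁺ r bs m b (y ∷ w) (φ ∘ (suc i ℕ.+_))) ≡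
      ∑₂ (wordCuts (y ∷ w)) (cutTerm-∷ x φ)
    ∑-remaining-∷ x y w φ IH false rxy = begin
      ∑ (upTo b) (λ i → chains⁺ r bs m b (y ∷ w) (φ ∘ (suc i ℕ.+_)))
        ≡⟨ ∑-cong (upTo b) (λ i → IH (φ ∘ (suc i ℕ.+_))) ⟩
      ∑ (upTo b) (λ i → ∑₂ (wordCuts (y ∷ w)) (cutTerm (φ ∘ (suc i ℕ.+_))))
        ≡⟨ ∑-cutTerm (y ∷ w) φ ⟩
      ∑₂ (wordCuts (y ∷ w)) (λ u u′ → ⟦ ascending r u ⟧ * weight b (suc (length u)) φ * chains r bs m u′)
        ≡⟨ wordCuts-cong-∷ y w (λ u u′ → ⟦ ascending r u ⟧ * weight b (suc (length u)) φ * chains r bs m u′) (cutTerm-∷ x φ) refl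
             (λ u u′ → cong (λ d → ⟦ not d ∧ ascending r (y ∷ u) ⟧ * weight b (suc (suc (length u))) φ * chains r bs m u′) (sym rxy)) ⟩
      ∑₂ (wordCuts (y ∷ w)) (cutTerm-∷ x φ) ∎
      where open ≡-Reasoning
    ∑-remaining-∷ x y w φ IH true rxy = begin
      ∑ (upTo b) (λ i → φ (suc i) * chains r bs m (y ∷ w))
        ≡⟨ ∑-*ʳ (upTo b) (φ ∘ suc) (chains r bs m (y ∷ w)) ⟨
      S * chains r bs m (y ∷ w)
        ≡⟨ wordCuts-counitˡ (y ∷ w) (λ u′ → S * chains r bs m u′) ⟨
      ∑₂ (wordCuts (y ∷ w)) (λ u u′ → ⟦ null u ⟧ * (S * chains r bs m u′))
        ≡⟨ wordCuts-cong-∷ y w (λ u u′ → ⟦ null u ⟧ * (S * chains r bs m u′)) (cutTerm-∷ x φ)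
             (trans (sym (*-assoc 1ℤ S _)) (cong (λ z → 1ℤ * z * chains r bs m (y ∷ w)) (sym (∑-first φ))))
             (λ u u′ → cong (λ d → ⟦ not d ∧ ascending r (y ∷ u) ⟧ * weight b (suc (suc (length u))) φ * chains r bs m u′) (sym rxy)) ⟩
      ∑₂ (wordCuts (y ∷ w)) (cutTerm-∷ x φ) ∎
      where
      open ≡-Reasoning
      S = ∑ (upTo b) (φ ∘ suc)

    ∑-remaining : ∀ x w (φ : ℕ → ℤ) → (∀ ψ → chains⁺ r bs m b w ψ ≡ ∑₂ (wordCuts w) (cutTerm ψ)) →
      ∑ (upTo b) (λ i → if startsWithDescent r x w then φ (suc i) * chains r bs m w else chains⁺ r bs m b w (φ ∘ (suc i ℕ.+_))) ≡
      ∑₂ (wordCuts w) (cutTerm-∷ x φ)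
    ∑-remaining x [] φ IH =
      trans (∑-cong (upTo b) (λ i → IH (φ ∘ (suc i ℕ.+_)))) (∑-cutTerm [] φ)
    ∑-remaining x (y ∷ w) φ IH = ∑-remaining-∷ x y w φ IH (r x y) refl

  -- The values containing the first variable form a prefix of the chain, joined by weak links, and
  -- all but the last are pure powers. If the last contains further variables, its letter is shared
  -- by `u` and `u′`; otherwise the cut is disjoint.
  chains⁺-cuts : ∀ w (φ : ℕ → ℤ) →
    chains⁺ r bs m b w φ ≡
    ∑₂ (wordCuts w) (λ u u′ → ⟦ ascending r u ⟧ * weight b (length u) φ * chains r bs m u′)
  chains⁺-cuts [] φ = regroup (φ 0) (hasWeight r bs m [])
    where
    regroup : ∀ p e → 1ℤ * (p * e) + 0ℤ ≡ 1ℤ * p * (1ℤ * e + 0ℤ) + 0ℤ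
    regroup = solve-∀
  chains⁺-cuts (x ∷ w) φ = begin
    chains⁺ r bs m b (x ∷ w) φ
      ≡⟨ chains⁺-∷ r bs m b x w φ ⟩
    ∑ (upTo (suc b)) φ * c + ∑ (upTo b) (λ i → if startsWithDescent r x w then φ (suc i) * chains r bs m w else chains⁺ r bs m b w (φ ∘ (suc i ℕ.+_)))
      ≡⟨ cong₂ _+_ (cong (_* c) (∑-upTo-suc b φ)) (∑-remaining x w φ (chains⁺-cuts w)) ⟩
    -- The exponents 0 and 1 to `b` of a first value containing later variables give the cut with
    -- `u` empty and the cut sharing `x`.
    (φ 0 + S) * c + rest′
      ≡⟨ distribute (φ 0) S c rest′ ⟩
    1ℤ * φ 0 * c + (1ℤ * S * c + rest′)
      ≡⟨ cong (λ z → 1ℤ * φ 0 * c + (1ℤ * z * c + rest′)) (∑-first φ) ⟨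
    1ℤ * φ 0 * c + (1ℤ * ∑ (upTo b) (λ i → φ (suc i ℕ.+ 0)) * c + rest′)
      ≡⟨ ∑-wordCuts-∷ x w (cutTerm φ) ⟨
    ∑₂ (wordCuts (x ∷ w)) (cutTerm φ) ∎
    where
    open ≡-Reasoning
    c = chains r bs m (x ∷ w)
    S = ∑ (upTo b) (φ ∘ suc)
    rest′ = ∑₂ (wordCuts w) (cutTerm-∷ x φ)
    distribute : ∀ p s c t → (p + s) * c + t ≡ 1ℤ * p * c + (1ℤ * s * c + t)
    distribute = solve-∀

vsumAll-glue : ∀ k σ → vsumAll (suc k) (map glue σ) ≡ sum (map proj₁ σ) ∷ vsumAll k (map proj₂ σ)
vsumAll-glue k []            = refl
vsumAll-glue k ((a , v) ∷ σ) = cong (zipWith ℕ._+_ (a ∷ v)) (vsumAll-glue k σ)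

chains-∷ : ∀ (r : A → A → Bool) b bs e m w →
  chains r (b ∷ bs) (e ∷ m) w ≡
  ∑₂ (wordCuts w) (λ u u′ → ⟦ ascending r u ⟧ * weight b (length u) (λ s → ⟦ s ≡ᵇ e ⟧) * chains r bs m u′)
chains-∷ r b bs e m w = begin
  ∑ (tuples n (boxes (b ∷ bs))) f
    ≡⟨ cong (λ xs → ∑ (tuples n xs) f) (map-glue-splitBoxes b bs) ⟨
  ∑ (tuples n (map glue (splitBoxes b bs))) f
    ≡⟨ ∑-tuples-map n glue (splitBoxes b bs) f ⟩
  ∑ (tuples n (splitBoxes b bs)) (f ∘ map glue)
    ≡⟨ ∑-cong (tuples n (splitBoxes b bs)) (λ σ → cong (⟦ valid (des r w) (map glue σ) ⟧ *_)
         (trans (cong (λ v → ⟦ eqVec v (e ∷ m) ⟧) (vsumAll-glue (length bs) σ)) (⟦∧⟧ (sum (map proj₁ σ) ≡ᵇ e) _))) ⟩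
  chains⁺ r bs m b w (λ s → ⟦ s ≡ᵇ e ⟧)
    ≡⟨ chains⁺-cuts r bs m b w _ ⟩
  ∑₂ (wordCuts w) (λ u u′ → ⟦ ascending r u ⟧ * weight b (length u) (λ s → ⟦ s ≡ᵇ e ⟧) * chains r bs m u′) ∎
  where
  open ≡-Reasoning
  n = length w
  f : List (List ℕ) → ℤ
  f t = ⟦ valid (des r w) t ⟧ * ⟦ eqVec (vsumAll (suc (length bs)) t) (e ∷ m) ⟧

valid-[] : ∀ ds σ → valid ds ([] ∷ σ) ≡ false
valid-[] ds       []      = refl
valid-[] []       (_ ∷ _) = refl
valid-[] (_ ∷ _)  (_ ∷ _) = refl

chains-[] : ∀ (r : A → A → Bool) w → chains r [] [] w ≡ ⟦ null w ⟧
chains-[] r []      = refl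
chains-[] r (x ∷ w) = trans (∑-tuples-suc (length w) ([] ∷ []) _)
  (∑-zero (tuples (length w) ([] ∷ [])) (λ t → cong (λ b → ⟦ b ⟧ * ⟦ eqVec (vsumAll 0 ([] ∷ t)) [] ⟧ + 0ℤ) (valid-[] (des r (x ∷ w)) t)))

-- Coefficients in one variable.

weight-one : ∀ l (φ : ℕ → ℤ) → weight 1 l φ ≡ φ l
weight-one zero    φ = refl
weight-one (suc l) φ = trans (+-identityʳ _) (weight-one l (φ ∘ suc))

weight-zero : ∀ b l → weight b l (λ _ → 0ℤ) ≡ 0ℤ
weight-zero b zero    = refl
weight-zero b (suc l) = ∑-zero (upTo b) (λ _ → weight-zero b l)

-- The number of compositions of e into l parts, i.e. the coefficient of xᵉ in (x/(1−x))ˡ.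
comps : ℕ → ℕ → ℤ
comps zero    e       = ⟦ e ≡ᵇ 0 ⟧
comps (suc l) zero    = 0ℤ
comps (suc l) (suc e) = comps (suc l) e + comps l e

-- No part of a composition of `e` exceeds `e`, so the bound `b` excludes nothing. In `firstPart`
-- the range `c` of the first part shrinks together with `e`, while the bound on the other parts
-- stays at `b`.
weight-comps : ∀ b l e → e ≤ b → weight b l (λ s → ⟦ s ≡ᵇ e ⟧) ≡ comps l e
weight-comps b zero    zero    _   = refl
weight-comps b zero    (suc e) _   = refl
weight-comps b (suc l) e       e≤b = firstPart b e e≤b e≤b
  where
  firstPart : ∀ c e → e ≤ c → e ≤ b → ∑ (upTo c) (λ i → weight b l (λ s → ⟦ suc i ℕ.+ s ≡ᵇ e ⟧)) ≡ comps (suc l) e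
  firstPart c       zero    _         _   = ∑-zero (upTo c) (λ _ → weight-zero b l)
  firstPart (suc c) (suc e) (s≤s e≤c) e<b =
    trans (∑-upTo-suc c (λ i → weight b l (λ s → ⟦ suc i ℕ.+ s ≡ᵇ suc e ⟧)))
      (trans (cong₂ _+_ (weight-comps b l e e≤b′) (firstPart c e e≤c e≤b′)) (+-comm (comps l e) _))
    where
    e≤b′ : e ≤ b
    e≤b′ = ℕ.<⇒≤ e<b

setChains multisetChains : (A → A → Bool) → Family A
setChains      r w m = chains r (replicate (length m) 1) m w
multisetChains r w m = chains r m m w

setChains-∷ : ∀ (r : A → A → Bool) w e m →
  setChains r w (e ∷ m) ≡ ∑₂ (wordCuts w) (λ u u′ → ⟦ ascending r u ⟧ * ⟦ length u ≡ᵇ e ⟧ * setChains r u′ m)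
setChains-∷ r w e m = trans (chains-∷ r 1 (replicate (length m) 1) e m w)
  (∑₂-cong (wordCuts w) (λ u u′ → cong (λ z → ⟦ ascending r u ⟧ * z * setChains r u′ m) (weight-one (length u) _)))

multisetChains-∷ : ∀ (r : A → A → Bool) w e m →
  multisetChains r w (e ∷ m) ≡ ∑₂ (wordCuts w) (λ u u′ → ⟦ ascending r u ⟧ * comps (length u) e * multisetChains r u′ m)
multisetChains-∷ r w e m = trans (chains-∷ r e m e m w)
  (∑₂-cong (wordCuts w) (λ u u′ → cong (λ z → ⟦ ascending r u ⟧ * z * multisetChains r u′ m) (weight-comps e (length u) e ℕ.≤-refl)))

-- Signs, reversal and the one-variable inverse

sgn : ℕ → ℤ
sgn zero    = 1ℤ
sgn (suc n) = - sgn n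

sgn-+ : ∀ a b → sgn (a ℕ.+ b) ≡ sgn a * sgn b
sgn-+ zero    b = sym (*-identityˡ (sgn b))
sgn-+ (suc a) b = trans (cong -_ (sgn-+ a b)) (neg-*ˡ (sgn a) (sgn b))
  where
  neg-*ˡ : ∀ a b → - (a * b) ≡ - a * b
  neg-*ˡ = solve-∀

descending : (A → A → Bool) → List A → Bool
descending r u = all id (des r u)

all-++ : ∀ (p : A → Bool) xs ys → all p (xs ++ ys) ≡ all p xs ∧ all p ys
all-++ p []       ys = refl
all-++ p (x ∷ xs) ys = trans (cong (p x ∧_) (all-++ p xs ys)) (sym (∧-assoc (p x) _ _))

all-reverse : ∀ (p : A → Bool) xs → all p (reverse xs) ≡ all p xs
all-reverse p []       = refl
all-reverse p (x ∷ xs) = begin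
  all p (reverse (x ∷ xs))          ≡⟨ cong (all p) (unfold-reverse x xs) ⟩
  all p (reverse xs ∷ʳ x)           ≡⟨ all-++ p (reverse xs) [ x ] ⟩
  all p (reverse xs) ∧ (p x ∧ true) ≡⟨ cong₂ _∧_ (all-reverse p xs) (∧-identityʳ (p x)) ⟩
  all p xs ∧ p x                    ≡⟨ ∧-comm (all p xs) (p x) ⟩
  all p (x ∷ xs)                    ∎
  where open ≡-Reasoning

-- The relation whose descents along the reversed word are the ascents of r along the word.
_ᵒ : (A → A → Bool) → A → A → Bool
(r ᵒ) x y = not (r y x)

des-∷ʳ∷ʳ : ∀ (r : A → A → Bool) w x y → des r ((w ∷ʳ x) ∷ʳ y) ≡ des r (w ∷ʳ x) ∷ʳ r x y
des-∷ʳ∷ʳ r []          x y = refl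
des-∷ʳ∷ʳ r (z ∷ [])    x y = refl
des-∷ʳ∷ʳ r (z ∷ t ∷ w) x y = cong (r z t ∷_) (des-∷ʳ∷ʳ r (t ∷ w) x y)

des-reverse : ∀ (r : A → A → Bool) w → des (r ᵒ) (reverse w) ≡ map not (reverse (des r w))
des-reverse r []          = refl
des-reverse r (x ∷ [])    = refl
des-reverse r (x ∷ y ∷ w) = begin
  des (r ᵒ) (reverse (x ∷ y ∷ w))
    ≡⟨ cong (des (r ᵒ)) (trans (unfold-reverse x (y ∷ w)) (cong (_∷ʳ x) (unfold-reverse y w))) ⟩
  des (r ᵒ) ((reverse w ∷ʳ y) ∷ʳ x)
    ≡⟨ des-∷ʳ∷ʳ (r ᵒ) (reverse w) y x ⟩
  des (r ᵒ) (reverse w ∷ʳ y) ∷ʳ not (r x y)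
    ≡⟨ cong (λ u → des (r ᵒ) u ∷ʳ not (r x y)) (unfold-reverse y w) ⟨
  des (r ᵒ) (reverse (y ∷ w)) ∷ʳ not (r x y)
    ≡⟨ cong (_∷ʳ not (r x y)) (des-reverse r (y ∷ w)) ⟩
  map not (reverse (des r (y ∷ w))) ∷ʳ not (r x y)
    ≡⟨ map-++ not (reverse (des r (y ∷ w))) [ r x y ] ⟨
  map not (reverse (des r (y ∷ w)) ∷ʳ r x y)
    ≡⟨ cong (map not) (unfold-reverse (r x y) (des r (y ∷ w))) ⟨
  map not (reverse (des r (x ∷ y ∷ w))) ∎
  where open ≡-Reasoning

ascending-reverse : ∀ (r : A → A → Bool) u → ascending (r ᵒ) (reverse u) ≡ descending r u
ascending-reverse r u = begin
  all not (des (r ᵒ) (reverse u))         ≡⟨ cong (all not) (des-reverse r u) ⟩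
  all not (map not (reverse (des r u)))   ≡⟨ not-not (reverse (des r u)) ⟩
  all id (reverse (des r u))              ≡⟨ all-reverse id (des r u) ⟩
  all id (des r u)                        ∎
  where
  open ≡-Reasoning
  not-not : ∀ ds → all not (map not ds) ≡ all id ds
  not-not []       = refl
  not-not (d ∷ ds) = cong₂ _∧_ (not-involutive d) (not-not ds)

∑-wordCuts-∷ʳ : ∀ w (x : A) (φ : List A → List A → ℤ) →
  ∑₂ (wordCuts (w ∷ʳ x)) φ ≡ φ (w ∷ʳ x) [] + (φ (w ∷ʳ x) [ x ] + ∑₂ (wordCuts w) (λ u u′ → φ u (u′ ∷ʳ x)))
∑-wordCuts-∷ʳ []      x φ = regroup (φ [] [ x ]) (φ [ x ] [ x ]) (φ [ x ] [])
  where
  regroup : ∀ a b c → a + (b + (c + 0ℤ)) ≡ c + (b + (a + 0ℤ))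
  regroup = solve-∀
∑-wordCuts-∷ʳ (y ∷ w) x φ = begin
  ∑₂ (wordCuts (y ∷ (w ∷ʳ x))) φ
    ≡⟨ ∑-wordCuts-∷ y (w ∷ʳ x) φ ⟩
  a + (b + ∑₂ (wordCuts (w ∷ʳ x)) (λ u u′ → φ (y ∷ u) u′))
    ≡⟨ cong (λ z → a + (b + z)) (∑-wordCuts-∷ʳ w x (λ u u′ → φ (y ∷ u) u′)) ⟩
  a + (b + (c + (d + e)))
    ≡⟨ regroup a b c d e ⟩
  c + (d + (a + (b + e)))
    ≡⟨ cong (λ z → c + (d + z)) (∑-wordCuts-∷ y w (λ u u′ → φ u (u′ ∷ʳ x))) ⟨
  c + (d + ∑₂ (wordCuts (y ∷ w)) (λ u u′ → φ u (u′ ∷ʳ x))) ∎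
  where
  open ≡-Reasoning
  a = φ [] (y ∷ (w ∷ʳ x))
  b = φ [ y ] (y ∷ (w ∷ʳ x))
  c = φ (y ∷ (w ∷ʳ x)) []
  d = φ (y ∷ (w ∷ʳ x)) [ x ]
  e = ∑₂ (wordCuts w) (λ u u′ → φ (y ∷ u) (u′ ∷ʳ x))
  regroup : ∀ a b c d e → a + (b + (c + (d + e))) ≡ c + (d + (a + (b + e)))
  regroup = solve-∀

-- Reversal is an anti-automorphism of the coalgebra of words; it moves the one-variable factor of
-- L̂ from the left to the right.
∑-wordCuts-reverse : ∀ (w : List A) (φ : List A → List A → ℤ) →
  ∑₂ (wordCuts (reverse w)) φ ≡ ∑₂ (wordCuts w) (λ u u′ → φ (reverse u′) (reverse u))
∑-wordCuts-reverse []      φ = refl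
∑-wordCuts-reverse (x ∷ w) φ = begin
  ∑₂ (wordCuts (reverse (x ∷ w))) φ
    ≡⟨ cong (λ v → ∑₂ (wordCuts v) φ) (unfold-reverse x w) ⟩
  ∑₂ (wordCuts (reverse w ∷ʳ x)) φ
    ≡⟨ ∑-wordCuts-∷ʳ (reverse w) x φ ⟩
  φ (reverse w ∷ʳ x) [] + (φ (reverse w ∷ʳ x) [ x ] + ∑₂ (wordCuts (reverse w)) (λ u u′ → φ u (u′ ∷ʳ x)))
    ≡⟨ cong (λ z → φ (reverse w ∷ʳ x) [] + (φ (reverse w ∷ʳ x) [ x ] + z)) (∑-wordCuts-reverse w (λ u u′ → φ u (u′ ∷ʳ x))) ⟩
  φ (reverse w ∷ʳ x) [] + (φ (reverse w ∷ʳ x) [ x ] + ∑₂ (wordCuts w) (λ u u′ → φ (reverse u′) (reverse u ∷ʳ x)))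
    ≡⟨ cong₂ (λ v z → φ v [] + (φ v [ x ] + z)) (unfold-reverse x w)
         (∑₂-cong (wordCuts w) (λ u u′ → cong (φ (reverse u′)) (unfold-reverse x u))) ⟨
  φ (reverse (x ∷ w)) [] + (φ (reverse (x ∷ w)) [ x ] + ∑₂ (wordCuts w) (λ u u′ → φ (reverse u′) (reverse (x ∷ u))))
    ≡⟨ ∑-wordCuts-∷ x w (λ u u′ → φ (reverse u′) (reverse u)) ⟨
  ∑₂ (wordCuts (x ∷ w)) (λ u u′ → φ (reverse u′) (reverse u)) ∎
  where open ≡-Reasoning

-- The claimed antipode in a form on which the recursion acts: reversal and `_ᵒ` stand for `ω`, the
-- sign for the substitution of -x.
antipodeChains : (A → A → Bool) → Family A
antipodeChains r w m = sgn (sum m) * multisetChains (r ᵒ) (reverse w) m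

-- With n the length of the word, the coefficients of xᵉ in xⁿ on ascending words and in yⁿ on
-- descending ones; the latter is expanded as (t/(1-t))ⁿ at t = -x.
setLetter antipodeLetter : (A → A → Bool) → List A → ℕ → ℤ
setLetter      r u e = ⟦ ascending r u ⟧ * ⟦ length u ≡ᵇ e ⟧
antipodeLetter r u e = ⟦ descending r u ⟧ * (sgn e * comps (length u) e)

antipodeChains-∷ : ∀ (r : A → A → Bool) w e m →
  antipodeChains r w (e ∷ m) ≡ ∑₂ (wordCuts w) (λ u u′ → antipodeChains r u m * antipodeLetter r u′ e)
antipodeChains-∷ r w e m = begin
  sgn (e ℕ.+ sum m) * multisetChains (r ᵒ) (reverse w) (e ∷ m)
    ≡⟨ cong₂ _*_ (sgn-+ e (sum m)) (trans (multisetChains-∷ (r ᵒ) (reverse w) e m) (∑-wordCuts-reverse w _)) ⟩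
  sgn e * sgn (sum m) * ∑₂ (wordCuts w) (λ u u′ → ⟦ ascending (r ᵒ) (reverse u′) ⟧ * comps (length (reverse u′)) e * multisetChains (r ᵒ) (reverse u) m)
    ≡⟨ ∑-*ˡ (wordCuts w) (sgn e * sgn (sum m)) _ ⟩
  ∑₂ (wordCuts w) (λ u u′ → sgn e * sgn (sum m) * (⟦ ascending (r ᵒ) (reverse u′) ⟧ * comps (length (reverse u′)) e * multisetChains (r ᵒ) (reverse u) m))
    ≡⟨ ∑₂-cong (wordCuts w) (λ u u′ → trans
         (cong₂ (λ d l → sgn e * sgn (sum m) * (⟦ d ⟧ * comps l e * multisetChains (r ᵒ) (reverse u) m)) (ascending-reverse r u′) (length-reverse u′))
         (rearrange (sgn e) (sgn (sum m)) ⟦ descending r u′ ⟧ (comps (length u′) e) (multisetChains (r ᵒ) (reverse u) m))) ⟩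
  ∑₂ (wordCuts w) (λ u u′ → antipodeChains r u m * antipodeLetter r u′ e) ∎
  where
  open ≡-Reasoning
  rearrange : ∀ s t d c h → s * t * (d * c * h) ≡ t * h * (d * (s * c))
  rearrange = solve-∀

-- For f l i = [xⁱ] yˡ with y = − x/(1+x): since y + x + x y = 0, the cuts of w at the end of its initial
-- descending run cancel.
module _ (r : A → A → Bool) where

  letterCuts : (ℕ → ℕ → ℤ) → List A → ℕ → ℕ → ℤ
  letterCuts f w i j = ∑₂ (wordCuts w) (λ u u′ → ⟦ descending r u ⟧ * f (length u) i * setLetter r u′ j)

  -- The cuts whose second factor is the whole word contribute nothing, as it starts with a descent.
  -- All others have `x` in the first factor only, and deleting it shifts `f`.
  letterCuts-descent : ∀ f x y w → r x y ≡ true → ∀ i j →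
    letterCuts f (x ∷ y ∷ w) i j ≡ letterCuts (f ∘ suc) (y ∷ w) i j
  letterCuts-descent f x y w xy i j = begin
    letterCuts f (x ∷ y ∷ w) i j
      ≡⟨ ∑-wordCuts-∷ x (y ∷ w) term ⟩
    1ℤ * f 0 i * setLetter r (x ∷ y ∷ w) j + (1ℤ * f 1 i * setLetter r (x ∷ y ∷ w) j + rest′)
      ≡⟨ cong (λ z → 1ℤ * f 0 i * z + (1ℤ * f 1 i * z + rest′)) (cong (λ d → ⟦ not d ∧ ascending r (y ∷ w) ⟧ * ⟦ suc (suc (length w)) ≡ᵇ j ⟧) xy) ⟩
    1ℤ * f 0 i * 0ℤ + (1ℤ * f 1 i * 0ℤ + rest′)
      ≡⟨ regroup (f 0 i) (f 1 i) rest′ ⟩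
    rest′
      ≡⟨ wordCuts-cong-∷ y w (λ u u′ → term (x ∷ u) u′) (λ u u′ → ⟦ descending r u ⟧ * f (suc (length u)) i * setLetter r u′ j) refl
           (λ u u′ → cong (λ d → ⟦ d ∧ descending r (y ∷ u) ⟧ * f (suc (suc (length u))) i * setLetter r u′ j) xy) ⟩
    letterCuts (f ∘ suc) (y ∷ w) i j ∎
    where
    open ≡-Reasoning
    term : List A → List A → ℤ
    term u u′ = ⟦ descending r u ⟧ * f (length u) i * setLetter r u′ j
    rest′ = ∑₂ (wordCuts (y ∷ w)) (λ u u′ → term (x ∷ u) u′)
    regroup : ∀ a b c → 1ℤ * a * 0ℤ + (1ℤ * b * 0ℤ + c) ≡ c
    regroup = solve-∀

  -- A descending first factor is empty or `[ x ]`, and `[ x ]` arises from a cut sharing `x` and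
  -- from a disjoint one.
  letterCuts-ascent : ∀ f x w → startsWithDescent r x w ≡ false → ∀ i j →
    letterCuts f (x ∷ w) i j ≡ (f 0 i + f 1 i) * setLetter r (x ∷ w) j + f 1 i * setLetter r w j
  letterCuts-ascent f x [] _ i j = regroup (f 0 i) (f 1 i) (setLetter r [ x ] j) (setLetter r [] j)
    where
    regroup : ∀ a b c d → 1ℤ * a * c + (1ℤ * b * c + (1ℤ * b * d + 0ℤ)) ≡ (a + b) * c + b * d
    regroup = solve-∀
  letterCuts-ascent f x (y ∷ w) xy i j = begin
    letterCuts f (x ∷ y ∷ w) i j
      ≡⟨ ∑-wordCuts-∷ x (y ∷ w) term ⟩
    1ℤ * f 0 i * c + (1ℤ * f 1 i * c + ∑₂ (wordCuts (y ∷ w)) (λ u u′ → term (x ∷ u) u′))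
      ≡⟨ cong (λ z → 1ℤ * f 0 i * c + (1ℤ * f 1 i * c + z))
           (wordCuts-cong-∷ y w (λ u u′ → term (x ∷ u) u′) (λ u u′ → ⟦ null u ⟧ * (f 1 i * setLetter r u′ j))
             (*-assoc 1ℤ (f 1 i) (setLetter r (y ∷ w) j))
             (λ u u′ → cong (λ d → ⟦ d ∧ descending r (y ∷ u) ⟧ * f (suc (suc (length u))) i * setLetter r u′ j) xy)) ⟩
    1ℤ * f 0 i * c + (1ℤ * f 1 i * c + ∑₂ (wordCuts (y ∷ w)) (λ u u′ → ⟦ null u ⟧ * (f 1 i * setLetter r u′ j)))
      ≡⟨ cong (λ z → 1ℤ * f 0 i * c + (1ℤ * f 1 i * c + z)) (wordCuts-counitˡ (y ∷ w) (λ u′ → f 1 i * setLetter r u′ j)) ⟩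
    1ℤ * f 0 i * c + (1ℤ * f 1 i * c + f 1 i * setLetter r (y ∷ w) j)
      ≡⟨ regroup (f 0 i) (f 1 i) c _ ⟩
    (f 0 i + f 1 i) * c + f 1 i * setLetter r (y ∷ w) j ∎
    where
    open ≡-Reasoning
    term : List A → List A → ℤ
    term u u′ = ⟦ descending r u ⟧ * f (length u) i * setLetter r u′ j
    c = setLetter r (x ∷ y ∷ w) j
    regroup : ∀ a b c d → 1ℤ * a * c + (1ℤ * b * c + d) ≡ (a + b) * c + d
    regroup = solve-∀

  setLetter-suc : ∀ x w → startsWithDescent r x w ≡ false → ∀ j → setLetter r (x ∷ w) (suc j) ≡ setLetter r w j
  setLetter-suc x []      _  j = refl
  setLetter-suc x (y ∷ w) xy j = cong (λ d → ⟦ not d ∧ ascending r (y ∷ w) ⟧ * ⟦ suc (length w) ≡ᵇ j ⟧) xy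

  -- The hypotheses say that the powers yˡ⁺¹ have no constant term and that yˡ(x + xy + y) = 0. Both
  -- persist under `f ∘ suc`, which absorbs the initial descending run.
  ∑-letterCuts : ∀ (f : ℕ → ℕ → ℤ) → (∀ l → f (suc l) 0 ≡ 0ℤ) → (∀ l i → f l i + f (suc l) i + f (suc l) (suc i) ≡ 0ℤ) →
    ∀ x w e → ∑₂ (splits e) (letterCuts f (x ∷ w)) ≡ 0ℤ
  ∑-letterCuts-ascent : ∀ (f : ℕ → ℕ → ℤ) → (∀ l → f (suc l) 0 ≡ 0ℤ) → (∀ l i → f l i + f (suc l) i + f (suc l) (suc i) ≡ 0ℤ) →
    ∀ x w → startsWithDescent r x w ≡ false → ∀ e → ∑₂ (splits e) (letterCuts f (x ∷ w)) ≡ 0ℤ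
  ∑-letterCuts f f0 f+ x []      e = ∑-letterCuts-ascent f f0 f+ x [] refl e
  ∑-letterCuts f f0 f+ x (y ∷ w) e = byDescent (r x y) refl
    where
    byDescent : ∀ d → r x y ≡ d → ∑₂ (splits e) (letterCuts f (x ∷ y ∷ w)) ≡ 0ℤ
    byDescent false xy = ∑-letterCuts-ascent f f0 f+ x (y ∷ w) xy e
    byDescent true  xy = trans (∑₂-cong (splits e) (letterCuts-descent f x y w xy))
                               (∑-letterCuts (f ∘ suc) (f0 ∘ suc) (f+ ∘ suc) y w e)
  ∑-letterCuts-ascent f f0 f+ x w asc e = trans (∑₂-cong (splits e) (letterCuts-ascent f x w asc)) (vanishes e)
    where
    open ≡-Reasoning
    c d : ℕ → ℤ
    c j = setLetter r (x ∷ w) j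
    d j = setLetter r w j
    c0 : c 0 ≡ 0ℤ
    c0 = *-zeroʳ ⟦ ascending r (x ∷ w) ⟧
    vanishes : ∀ e → ∑₂ (splits e) (λ i j → (f 0 i + f 1 i) * c j + f 1 i * d j) ≡ 0ℤ
    vanishes zero = begin
      (f 0 0 + f 1 0) * c 0 + f 1 0 * d 0 + 0ℤ ≡⟨ cong₂ (λ s t → (f 0 0 + f 1 0) * s + t * d 0 + 0ℤ) c0 (f0 0) ⟩
      (f 0 0 + f 1 0) * 0ℤ + 0ℤ * d 0 + 0ℤ     ≡⟨ regroup (f 0 0 + f 1 0) (d 0) ⟩
      0ℤ                                       ∎
      where
      regroup : ∀ a b → a * 0ℤ + 0ℤ * b + 0ℤ ≡ 0ℤ
      regroup = solve-∀
    vanishes (suc e) = begin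
      ∑₂ (splits (suc e)) (λ i j → (f 0 i + f 1 i) * c j + f 1 i * d j)
        ≡⟨ ∑-+ (splits (suc e)) (λ (i , j) → (f 0 i + f 1 i) * c j) (λ (i , j) → f 1 i * d j) ⟩
      ∑₂ (splits (suc e)) (λ i j → (f 0 i + f 1 i) * c j) + ∑₂ (splits (suc e)) (λ i j → f 1 i * d j)
        -- Peeling from opposite ends lines up the powers of x; the boundary terms vanish because
        -- `c 0` and `f 1 0` are 0.
        ≡⟨ cong₂ _+_ (∑-splits-sucʳ e (λ i j → (f 0 i + f 1 i) * c j)) (∑-splits-suc e (λ i j → f 1 i * d j)) ⟩
      (∑₂ (splits e) (λ i j → (f 0 i + f 1 i) * c (suc j)) + (f 0 (suc e) + f 1 (suc e)) * c 0) +
      (f 1 0 * d (suc e) + ∑₂ (splits e) (λ i j → f 1 (suc i) * d j))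
        ≡⟨ cong₂ (λ s t → (S + (f 0 (suc e) + f 1 (suc e)) * s) + (t * d (suc e) + T)) c0 (f0 0) ⟩
      (S + (f 0 (suc e) + f 1 (suc e)) * 0ℤ) + (0ℤ * d (suc e) + T)
        ≡⟨ regroup S (f 0 (suc e) + f 1 (suc e)) (d (suc e)) T ⟩
      S + T
        ≡⟨ ∑-+ (splits e) _ _ ⟨
      ∑₂ (splits e) (λ i j → (f 0 i + f 1 i) * c (suc j) + f 1 (suc i) * d j)
        ≡⟨ ∑-zero (splits e) (λ (i , j) → cancel i j) ⟩
      0ℤ ∎
      where
      S = ∑₂ (splits e) (λ i j → (f 0 i + f 1 i) * c (suc j))
      T = ∑₂ (splits e) (λ i j → f 1 (suc i) * d j)
      regroup : ∀ s a b t → (s + a * 0ℤ) + (0ℤ * b + t) ≡ s + t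
      regroup = solve-∀
      cancel : ∀ i j → (f 0 i + f 1 i) * c (suc j) + f 1 (suc i) * d j ≡ 0ℤ
      cancel i j = begin
        (f 0 i + f 1 i) * c (suc j) + f 1 (suc i) * d j ≡⟨ cong (λ z → (f 0 i + f 1 i) * z + f 1 (suc i) * d j) (setLetter-suc x w asc j) ⟩
        (f 0 i + f 1 i) * d j + f 1 (suc i) * d j       ≡⟨ *-distribʳ-+ (d j) (f 0 i + f 1 i) (f 1 (suc i)) ⟨
        (f 0 i + f 1 i + f 1 (suc i)) * d j             ≡⟨ cong (_* d j) (f+ 0 i) ⟩
        0ℤ * d j                                        ≡⟨ *-zeroˡ (d j) ⟩
        0ℤ                                              ∎

  letter-inverse : ∀ w e →
    ∑₂ (splits e) (λ i j → ∑₂ (wordCuts w) (λ u u′ → antipodeLetter r u i * setLetter r u′ j)) ≡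
    ⟦ null w ⟧ * ⟦ e ≡ᵇ 0 ⟧
  letter-inverse [] e = begin
    ∑₂ (splits e) (λ i j → 1ℤ * (sgn i * ⟦ i ≡ᵇ 0 ⟧) * (1ℤ * ⟦ 0 ≡ᵇ j ⟧) + 0ℤ)
      ≡⟨ ∑₂-cong (splits e) simplify ⟩
    ∑₂ (splits e) (λ i j → ⟦ i ≡ᵇ 0 ⟧ * ⟦ 0 ≡ᵇ j ⟧)
      ≡⟨ splits-counitˡ e (λ j → ⟦ 0 ≡ᵇ j ⟧) ⟩
    ⟦ 0 ≡ᵇ e ⟧
      ≡⟨ ≡ᵇ-sym e ⟩
    1ℤ * ⟦ e ≡ᵇ 0 ⟧ ∎
    where
    open ≡-Reasoning
    sl₀ : ∀ a → 1ℤ * 1ℤ * (1ℤ * a) + 0ℤ ≡ 1ℤ * a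
    sl₀ = solve-∀
    sl₁ : ∀ s a → 1ℤ * (s * 0ℤ) * (1ℤ * a) + 0ℤ ≡ 0ℤ * a
    sl₁ = solve-∀
    simplify : ∀ i j → 1ℤ * (sgn i * ⟦ i ≡ᵇ 0 ⟧) * (1ℤ * ⟦ 0 ≡ᵇ j ⟧) + 0ℤ ≡ ⟦ i ≡ᵇ 0 ⟧ * ⟦ 0 ≡ᵇ j ⟧
    simplify zero    j = sl₀ ⟦ 0 ≡ᵇ j ⟧
    simplify (suc i) j = sl₁ (sgn (suc i)) ⟦ 0 ≡ᵇ j ⟧
    ≡ᵇ-sym : ∀ e → ⟦ 0 ≡ᵇ e ⟧ ≡ 1ℤ * ⟦ e ≡ᵇ 0 ⟧
    ≡ᵇ-sym zero    = refl
    ≡ᵇ-sym (suc e) = refl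
  -- With the signs put in, the relation y + x + xy = 0 is the defining recursion of `comps`.
  letter-inverse (x ∷ w) e = ∑-letterCuts (λ l i → sgn i * comps l i) (λ _ → refl) (λ l i → regroup (sgn i) (comps l i) (comps (suc l) i)) x w e
    where
    regroup : ∀ s a b → s * a + s * b + - s * (b + a) ≡ 0ℤ
    regroup = solve-∀

-- The explicit left inverse, by induction on the number of variables.

∑₂-swap₂₂ : ∀ {A₁ B₁ A₂ B₂ A₃ B₃ A₄ B₄ : Set} (ps : List (A₁ × B₁)) (qs : List (A₂ × B₂)) (rs : List (A₃ × B₃)) (ss : List (A₄ × B₄))
  (f : A₁ → B₁ → A₂ → B₂ → A₃ → B₃ → A₄ → B₄ → ℤ) →
  ∑₂ ps (λ a a′ → ∑₂ qs (λ b b′ → ∑₂ rs (λ c c′ → ∑₂ ss (λ d d′ → f a a′ b b′ c c′ d d′)))) ≡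
  ∑₂ rs (λ c c′ → ∑₂ ss (λ d d′ → ∑₂ ps (λ a a′ → ∑₂ qs (λ b b′ → f a a′ b b′ c c′ d d′))))
∑₂-swap₂₂ ps qs rs ss f = begin
  ∑₂ ps (λ a a′ → ∑₂ qs (λ b b′ → ∑₂ rs (λ c c′ → ∑₂ ss (λ d d′ → f a a′ b b′ c c′ d d′))))
    ≡⟨ ∑₂-cong ps (λ a a′ → ∑₂-swap qs rs (λ b b′ c c′ → ∑₂ ss (λ d d′ → f a a′ b b′ c c′ d d′))) ⟩
  ∑₂ ps (λ a a′ → ∑₂ rs (λ c c′ → ∑₂ qs (λ b b′ → ∑₂ ss (λ d d′ → f a a′ b b′ c c′ d d′))))
    ≡⟨ ∑₂-swap ps rs (λ a a′ c c′ → ∑₂ qs (λ b b′ → ∑₂ ss (λ d d′ → f a a′ b b′ c c′ d d′))) ⟩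
  ∑₂ rs (λ c c′ → ∑₂ ps (λ a a′ → ∑₂ qs (λ b b′ → ∑₂ ss (λ d d′ → f a a′ b b′ c c′ d d′))))
    ≡⟨ ∑₂-cong rs (λ c c′ → ∑₂-cong ps (λ a a′ → ∑₂-swap qs ss (λ b b′ d d′ → f a a′ b b′ c c′ d d′))) ⟩
  ∑₂ rs (λ c c′ → ∑₂ ps (λ a a′ → ∑₂ ss (λ d d′ → ∑₂ qs (λ b b′ → f a a′ b b′ c c′ d d′))))
    ≡⟨ ∑₂-cong rs (λ c c′ → ∑₂-swap ps ss (λ a a′ d d′ → ∑₂ qs (λ b b′ → f a a′ b b′ c c′ d d′))) ⟩
  ∑₂ rs (λ c c′ → ∑₂ ss (λ d d′ → ∑₂ ps (λ a a′ → ∑₂ qs (λ b b′ → f a a′ b b′ c c′ d d′)))) ∎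
  where open ≡-Reasoning

∑₂-*-∑₂ : ∀ {A₁ B₁ A₂ B₂ : Set} (ps : List (A₁ × B₁)) (qs : List (A₂ × B₂)) (f : A₁ → B₁ → ℤ) (g : A₂ → B₂ → ℤ) →
  ∑₂ ps f * ∑₂ qs g ≡ ∑₂ ps (λ a a′ → ∑₂ qs (λ b b′ → f a a′ * g b b′))
∑₂-*-∑₂ ps qs f g =
  trans (∑-*ʳ ps (uncurry f) (∑₂ qs g)) (∑₂-cong ps (λ a a′ → ∑-*ˡ qs (f a a′) (uncurry g)))

-- The first variable contributes the innermost factors, so antipodeLetter ⋆ setLetter cancels
-- in the middle of antipodeChains ⋆ setChains.
antipodeChains-inverse : ∀ (r : A → A → Bool) m w → (antipodeChains r ⋆ setChains r) w m ≡ δ w m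
antipodeChains-inverse r [] w = begin
  ∑₂ (wordCuts w) (λ u u′ → antipodeChains r u [] * setChains r u′ [] + 0ℤ)
    ≡⟨ ∑₂-cong (wordCuts w) (λ u u′ → trans
         (cong₂ (λ x y → 1ℤ * x * y + 0ℤ) (trans (chains-[] (r ᵒ) (reverse u)) (null-reverse u)) (chains-[] r u′))
         (regroup ⟦ null u ⟧ ⟦ null u′ ⟧)) ⟩
  ∑₂ (wordCuts w) (λ u u′ → ⟦ null u ⟧ * ⟦ null u′ ⟧)
    ≡⟨ wordCuts-counitˡ w (λ u′ → ⟦ null u′ ⟧) ⟩
  ⟦ null w ⟧
    ≡⟨ *-identityʳ ⟦ null w ⟧ ⟨
  δ w [] ∎
  where
  open ≡-Reasoning
  regroup : ∀ a b → 1ℤ * a * b + 0ℤ ≡ a * b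
  regroup = solve-∀
  null-++-[] : ∀ (u : List _) x → null (u ∷ʳ x) ≡ false
  null-++-[] []      x = refl
  null-++-[] (_ ∷ _) x = refl
  null-reverse : ∀ u → ⟦ null (reverse u) ⟧ ≡ ⟦ null u ⟧
  null-reverse []      = refl
  null-reverse (x ∷ u) = cong ⟦_⟧ (trans (cong null (unfold-reverse x u)) (null-++-[] (reverse u) x))
antipodeChains-inverse {A = A} r (e ∷ m) w = begin
  (M ⋆ L) w (e ∷ m)
    ≡⟨ ∑₂-cong (wordCuts w) expand ⟩
  ∑₂ (wordCuts w) (λ u u′ → ∑₂ (wordCuts u) (λ a b → ∑₂ (wordCuts u′) (Φ a b)))
    -- Regroups the four factors from (a b)(c d) to a ((b c) d), so that the one-variable factors
    -- meet.
    ≡⟨ wordCuts-coassoc w (λ a b u′ → ∑₂ (wordCuts u′) (Φ a b)) ⟩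
  ∑₂ (wordCuts w) (λ a s → ∑₂ (wordCuts s) (λ b u′ → ∑₂ (wordCuts u′) (Φ a b)))
    ≡⟨ ∑₂-cong (wordCuts w) (λ a s → wordCuts-coassoc s (Φ a)) ⟨
  ∑₂ (wordCuts w) (λ a s → ∑₂ (wordCuts s) (λ t d → ∑₂ (wordCuts t) (λ b c → Φ a b c d)))
    ≡⟨ ∑₂-cong (wordCuts w) (λ a s → ∑₂-cong (wordCuts s) (λ t d → collapse a t d)) ⟩
  ∑₂ (wordCuts w) (λ a s → ∑₂ (wordCuts s) (λ t d → ⟦ null t ⟧ * (⟦ e ≡ᵇ 0 ⟧ * Ψ a d)))
    ≡⟨ ∑₂-cong (wordCuts w) (λ a s → wordCuts-counitˡ s (λ d → ⟦ e ≡ᵇ 0 ⟧ * Ψ a d)) ⟩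
  ∑₂ (wordCuts w) (λ a s → ⟦ e ≡ᵇ 0 ⟧ * Ψ a s)
    ≡⟨ ∑-*ˡ (wordCuts w) ⟦ e ≡ᵇ 0 ⟧ (uncurry Ψ) ⟨
  ⟦ e ≡ᵇ 0 ⟧ * (M ⋆ L) w m
    ≡⟨ cong (⟦ e ≡ᵇ 0 ⟧ *_) (antipodeChains-inverse r m w) ⟩
  ⟦ e ≡ᵇ 0 ⟧ * (⟦ null w ⟧ * ⟦ isZeroVec m ⟧)
    ≡⟨ swap* ⟦ e ≡ᵇ 0 ⟧ ⟦ null w ⟧ ⟦ isZeroVec m ⟧ ⟩
  ⟦ null w ⟧ * (⟦ e ≡ᵇ 0 ⟧ * ⟦ isZeroVec m ⟧)
    ≡⟨ cong (⟦ null w ⟧ *_) (⟦∧⟧ (e ≡ᵇ 0) (isZeroVec m)) ⟨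
  δ w (e ∷ m) ∎
  where
  open ≡-Reasoning
  M L : Family A
  M = antipodeChains r
  L = setChains r
  M₁ L₁ : List A → ℕ → ℤ
  M₁ = antipodeLetter r
  L₁ = setLetter r
  Ψ : List A → List A → ℤ
  Ψ a d = ∑₂ (boxSplits m) (λ v v′ → M a v * L d v′)
  Φ : List A → List A → List A → List A → ℤ
  Φ a b c d = ∑₂ (splits e) (λ i j → M₁ b i * L₁ c j * Ψ a d)
  swap* : ∀ a b c → a * (b * c) ≡ b * (a * c)
  swap* = solve-∀
  interchange : ∀ a b c d → a * b * (c * d) ≡ b * c * (a * d)
  interchange = solve-∀
  expand : ∀ u u′ → ∑₂ (boxSplits (e ∷ m)) (λ v v′ → M u v * L u′ v′) ≡
                    ∑₂ (wordCuts u) (λ a b → ∑₂ (wordCuts u′) (Φ a b))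
  expand u u′ = begin
    ∑₂ (boxSplits (e ∷ m)) (λ v v′ → M u v * L u′ v′)
      ≡⟨ ∑-boxSplits-∷ e m (λ v v′ → M u v * L u′ v′) ⟩
    ∑₂ (splits e) (λ i j → ∑₂ (boxSplits m) (λ v v′ → M u (i ∷ v) * L u′ (j ∷ v′)))
      ≡⟨ ∑₂-cong (splits e) (λ i j → ∑₂-cong (boxSplits m) (λ v v′ → trans
           (cong₂ _*_ (antipodeChains-∷ r u i v) (setChains-∷ r u′ j v′))
           (∑₂-*-∑₂ (wordCuts u) (wordCuts u′) (λ a b → M a v * M₁ b i) (λ c d → L₁ c j * L d v′)))) ⟩
    ∑₂ (splits e) (λ i j → ∑₂ (boxSplits m) (λ v v′ → ∑₂ (wordCuts u) (λ a b → ∑₂ (wordCuts u′) (λ c d →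
      M a v * M₁ b i * (L₁ c j * L d v′)))))
      ≡⟨ ∑₂-swap₂₂ (splits e) (boxSplits m) (wordCuts u) (wordCuts u′) (λ i j v v′ a b c d → M a v * M₁ b i * (L₁ c j * L d v′)) ⟩
    ∑₂ (wordCuts u) (λ a b → ∑₂ (wordCuts u′) (λ c d → ∑₂ (splits e) (λ i j → ∑₂ (boxSplits m) (λ v v′ →
      M a v * M₁ b i * (L₁ c j * L d v′)))))
      ≡⟨ ∑₂-cong (wordCuts u) (λ a b → ∑₂-cong (wordCuts u′) (λ c d → ∑₂-cong (splits e) (λ i j → trans
           (∑₂-cong (boxSplits m) (λ v v′ → interchange (M a v) (M₁ b i) (L₁ c j) (L d v′)))
           (sym (∑-*ˡ (boxSplits m) (M₁ b i * L₁ c j) (λ (v , v′) → M a v * L d v′)))))) ⟩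
    ∑₂ (wordCuts u) (λ a b → ∑₂ (wordCuts u′) (Φ a b)) ∎
  collapse : ∀ a t d → ∑₂ (wordCuts t) (λ b c → Φ a b c d) ≡ ⟦ null t ⟧ * (⟦ e ≡ᵇ 0 ⟧ * Ψ a d)
  collapse a t d = begin
    ∑₂ (wordCuts t) (λ b c → ∑₂ (splits e) (λ i j → M₁ b i * L₁ c j * Ψ a d))
      ≡⟨ ∑₂-cong (wordCuts t) (λ b c → ∑-*ʳ (splits e) (λ (i , j) → M₁ b i * L₁ c j) (Ψ a d)) ⟨
    ∑₂ (wordCuts t) (λ b c → ∑₂ (splits e) (λ i j → M₁ b i * L₁ c j) * Ψ a d)
      ≡⟨ ∑-*ʳ (wordCuts t) (λ (b , c) → ∑₂ (splits e) (λ i j → M₁ b i * L₁ c j)) (Ψ a d) ⟨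
    ∑₂ (wordCuts t) (λ b c → ∑₂ (splits e) (λ i j → M₁ b i * L₁ c j)) * Ψ a d
      ≡⟨ cong (_* Ψ a d) (∑₂-swap (wordCuts t) (splits e) (λ b c i j → M₁ b i * L₁ c j)) ⟩
    ∑₂ (splits e) (λ i j → ∑₂ (wordCuts t) (λ b c → M₁ b i * L₁ c j)) * Ψ a d
      ≡⟨ cong (_* Ψ a d) (letter-inverse r t e) ⟩
    ⟦ null t ⟧ * ⟦ e ≡ᵇ 0 ⟧ * Ψ a d
      ≡⟨ *-assoc ⟦ null t ⟧ ⟦ e ≡ᵇ 0 ⟧ (Ψ a d) ⟩
    ⟦ null t ⟧ * (⟦ e ≡ᵇ 0 ⟧ * Ψ a d) ∎

-- Compositions, descent sets and words

-- As for maxSuppFrom: the local functions of fromDesc and negVars, made available for induction.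
mutual
  fromDescFrom : ℕ → List Bool → Comp
  fromDescFrom = _

  fromDesc-fromDescFrom : ∀ bs → fromDesc bs ≡ fromDescFrom 1 bs
  fromDesc-fromDescFrom bs with 1
  ... | c = refl

mutual
  negVarsAt : PS → Monomial → ℕ → ℤ
  negVarsAt = _

  negVars-negVarsAt : ∀ f m → negVars f m ≡ negVarsAt f m (sum m)
  negVars-negVarsAt f m with sum m
  ... | n = refl

negVars-sgn : ∀ f m → negVars f m ≡ sgn (sum m) * f m
negVars-sgn f m = trans (negVars-negVarsAt f m) (at (sum m))
  where
  at : ∀ n → negVarsAt f m n ≡ sgn n * f m
  at zero          = refl
  at (suc zero)    = refl
  at (suc (suc n)) = trans (at n) (cong (_* f m) (sym (neg-involutive (sgn n))))

size-fromDescFrom : ∀ c bs → size (fromDescFrom c bs) ≡ c ℕ.+ length bs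
size-fromDescFrom c []           = refl
size-fromDescFrom c (true  ∷ bs) = cong (c ℕ.+_) (size-fromDescFrom 1 bs)
size-fromDescFrom c (false ∷ bs) = trans (size-fromDescFrom (suc c) bs) (sym (ℕ.+-suc c (length bs)))

IsComp-fromDescFrom : ∀ c bs → IsComp (fromDescFrom (suc c) bs)
IsComp-fromDescFrom c []           = s≤s z≤n ∷ []
IsComp-fromDescFrom c (true  ∷ bs) = s≤s z≤n ∷ IsComp-fromDescFrom 0 bs
IsComp-fromDescFrom c (false ∷ bs) = IsComp-fromDescFrom (suc c) bs

fromDescFrom-∷ : ∀ c bs → ∃₂ λ a α → fromDescFrom c bs ≡ a ∷ α
fromDescFrom-∷ c []           = c , [] , refl
fromDescFrom-∷ c (true  ∷ bs) = c , _ , refl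
fromDescFrom-∷ c (false ∷ bs) = fromDescFrom-∷ (suc c) bs

replicate-∷ʳ : ∀ n (x : A) xs → x ∷ (replicate n x ++ xs) ≡ replicate n x ++ x ∷ xs
replicate-∷ʳ zero    x xs = refl
replicate-∷ʳ (suc n) x xs = cong (x ∷_) (replicate-∷ʳ n x xs)

reverse-replicate : ∀ n (x : A) → reverse (replicate n x) ≡ replicate n x
reverse-replicate zero    x = refl
reverse-replicate (suc n) x = begin
  reverse (x ∷ replicate n x) ≡⟨ unfold-reverse x (replicate n x) ⟩
  reverse (replicate n x) ∷ʳ x ≡⟨ cong (_∷ʳ x) (reverse-replicate n x) ⟩
  replicate n x ∷ʳ x           ≡⟨ replicate-∷ʳ n x [] ⟨
  x ∷ (replicate n x ++ [])    ≡⟨ cong (x ∷_) (++-identityʳ (replicate n x)) ⟩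
  replicate (suc n) x          ∎
  where open ≡-Reasoning

-- An accumulator `suc c` means that the current part has already absorbed `c` non-descents.
descSet-fromDescFrom : ∀ c bs → descSet (fromDescFrom (suc c) bs) ≡ replicate c false ++ bs
descSet-fromDescFrom c []           = sym (++-identityʳ (replicate c false))
descSet-fromDescFrom c (false ∷ bs) = trans (descSet-fromDescFrom (suc c) bs) (replicate-∷ʳ c false bs)
-- `descSet` treats the last part differently from the others, so the composition that follows must
-- be exposed as nonempty.
descSet-fromDescFrom c (true ∷ bs) with fromDescFrom 1 bs | fromDescFrom-∷ 1 bs | descSet-fromDescFrom 0 bs
... | _ | _ , _ , refl | eq = cong (λ ds → replicate c false ++ true ∷ ds) eq

fromDescFrom-replicate : ∀ c n bs → fromDescFrom c (replicate n false ++ bs) ≡ fromDescFrom (n ℕ.+ c) bs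
fromDescFrom-replicate c zero    bs = refl
fromDescFrom-replicate c (suc n) bs =
  trans (fromDescFrom-replicate (suc c) n bs) (cong (λ k → fromDescFrom k bs) (ℕ.+-suc n c))

fromDescFrom-descSet : ∀ a α → IsComp (a ∷ α) → fromDescFrom 1 (descSet (a ∷ α)) ≡ a ∷ α
fromDescFrom-descSet (suc a) [] (s≤s _ ∷ []) = begin
  fromDescFrom 1 (replicate a false)       ≡⟨ cong (fromDescFrom 1) (++-identityʳ (replicate a false)) ⟨
  fromDescFrom 1 (replicate a false ++ []) ≡⟨ fromDescFrom-replicate 1 a [] ⟩
  (a ℕ.+ 1) ∷ []                           ≡⟨ cong (_∷ []) (ℕ.+-comm a 1) ⟩
  suc a ∷ []                               ∎
  where open ≡-Reasoning
fromDescFrom-descSet (suc a) (b ∷ α) (s≤s _ ∷ α-comp) =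
  trans (fromDescFrom-replicate 1 a (true ∷ descSet (b ∷ α)))
    (cong₂ _∷_ (ℕ.+-comm a 1) (fromDescFrom-descSet b α α-comp))

descSet-∷ʳ∷ʳ : ∀ α a b → descSet ((α ∷ʳ a) ∷ʳ b) ≡ descSet (α ∷ʳ a) ++ true ∷ replicate (b ∸ 1) false
descSet-∷ʳ∷ʳ []          a b = refl
descSet-∷ʳ∷ʳ (c ∷ [])    a b = sym (++-assoc (replicate (c ∸ 1) false) _ _)
descSet-∷ʳ∷ʳ (c ∷ d ∷ α) a b =
  trans (cong (λ ds → replicate (c ∸ 1) false ++ true ∷ ds) (descSet-∷ʳ∷ʳ (d ∷ α) a b))
        (sym (++-assoc (replicate (c ∸ 1) false) _ _))

descSet-reverse : ∀ α → descSet (reverse α) ≡ reverse (descSet α)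
descSet-reverse []          = refl
descSet-reverse (a ∷ [])    = sym (reverse-replicate (a ∸ 1) false)
descSet-reverse (a ∷ b ∷ α) = begin
  descSet (reverse (a ∷ b ∷ α))
    ≡⟨ cong descSet (trans (unfold-reverse a (b ∷ α)) (cong (_∷ʳ a) (unfold-reverse b α))) ⟩
  descSet ((reverse α ∷ʳ b) ∷ʳ a)
    ≡⟨ descSet-∷ʳ∷ʳ (reverse α) b a ⟩
  descSet (reverse α ∷ʳ b) ++ true ∷ replicate (a ∸ 1) false
    ≡⟨ cong (λ β → descSet β ++ true ∷ replicate (a ∸ 1) false) (unfold-reverse b α) ⟨
  descSet (reverse (b ∷ α)) ++ true ∷ replicate (a ∸ 1) false
    ≡⟨ cong₂ (λ ds es → ds ++ true ∷ es) (descSet-reverse (b ∷ α)) (sym (reverse-replicate (a ∸ 1) false)) ⟩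
  reverse (descSet (b ∷ α)) ++ true ∷ reverse (replicate (a ∸ 1) false)
    ≡⟨ ++-assoc (reverse (descSet (b ∷ α))) [ true ] _ ⟨
  (reverse (descSet (b ∷ α)) ∷ʳ true) ++ reverse (replicate (a ∸ 1) false)
    ≡⟨ cong (_++ reverse (replicate (a ∸ 1) false)) (unfold-reverse true (descSet (b ∷ α))) ⟨
  reverse (true ∷ descSet (b ∷ α)) ++ reverse (replicate (a ∸ 1) false)
    ≡⟨ reverse-++ (replicate (a ∸ 1) false) (true ∷ descSet (b ∷ α)) ⟨
  reverse (descSet (a ∷ b ∷ α)) ∎
  where open ≡-Reasoning

length-wordOf : ∀ α → length (wordOf α) ≡ size α
length-wordOf []      = refl
length-wordOf (a ∷ α) = trans (length-++ (applyUpTo _ a)) (cong₂ ℕ._+_ (length-applyUpTo _ a) (length-wordOf α))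

desW-applyUpTo-++ : ∀ (f : ℕ → ℕ) → (∀ i → (f (suc i) <ᵇ f i) ≡ false) → ∀ a t →
  desW (applyUpTo f (suc a) ++ t) ≡ replicate a false ++ desW (f a ∷ t)
desW-applyUpTo-++ f f-inc zero    t = refl
desW-applyUpTo-++ f f-inc (suc a) t = cong₂ _∷_ (f-inc 0) (desW-applyUpTo-++ (f ∘ suc) (f-inc ∘ suc) a t)

<ᵇ-true : ∀ {m n} → m ℕ.< n → (m <ᵇ n) ≡ true
<ᵇ-true {zero}  (s≤s _)   = refl
<ᵇ-true {suc m} (s≤s m<n) = <ᵇ-true m<n

<ᵇ-false : ∀ {m n} → n ≤ m → (m <ᵇ n) ≡ false
<ᵇ-false z≤n       = refl
<ᵇ-false (s≤s n≤m) = <ᵇ-false n≤m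

-- Blocks increase, and every value of a block exceeds all values of later ones, so descents fall
-- exactly at the block ends.
desW-wordOf : ∀ α → IsComp α → desW (wordOf α) ≡ descSet α
desW-wordOf [] _ = refl
desW-wordOf (suc a ∷ α) (s≤s _ ∷ α-comp) =
  trans (desW-applyUpTo-++ (λ i → suc (size α ℕ.+ i)) (λ i → <ᵇ-false (ℕ.+-monoʳ-≤ (size α) (ℕ.n≤1+n i))) a (wordOf α))
    (tail α α-comp)
  where
  tail : ∀ β → IsComp β → replicate a false ++ desW (suc (size β ℕ.+ a) ∷ wordOf β) ≡ descSet (suc a ∷ β)
  tail []          _      = ++-identityʳ (replicate a false)
  tail (suc b ∷ β) β-comp@(s≤s _ ∷ _) = cong₂ (λ d ds → replicate a false ++ d ∷ ds)
    (<ᵇ-true {size β ℕ.+ 0} {suc b ℕ.+ size β ℕ.+ a}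
      (s≤s (ℕ.+-mono-≤ (ℕ.m≤n+m (size β) b) z≤n)))
    (desW-wordOf (suc b ∷ β) β-comp)

length-desW : ∀ x w → length (desW (x ∷ w)) ≡ length w
length-desW x []      = refl
length-desW x (y ∷ w) = cong suc (length-desW y w)

IsComp-C : ∀ w → IsComp (C w)
IsComp-C []      = []
IsComp-C (x ∷ w) = IsComp-fromDescFrom 0 (desW (x ∷ w))

C-wordOf : ∀ α → IsComp α → C (wordOf α) ≡ α
C-wordOf []          _      = refl
C-wordOf (suc a ∷ α) α-comp@(s≤s _ ∷ _) =
  trans (cong fromDesc (desW-wordOf (suc a ∷ α) α-comp)) (fromDescFrom-descSet (suc a) α α-comp)

length-wordOf-C : ∀ w → length (wordOf (C w)) ≡ length w
length-wordOf-C []      = refl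
length-wordOf-C (x ∷ w) =
  trans (length-wordOf (C (x ∷ w))) (trans (size-fromDescFrom 1 (desW (x ∷ w))) (cong suc (length-desW x w)))

desW-wordOf-C : ∀ w → desW (wordOf (C w)) ≡ desW w
desW-wordOf-C []      = refl
desW-wordOf-C (x ∷ w) = trans (desW-wordOf (C (x ∷ w)) (IsComp-C (x ∷ w))) (descSet-fromDescFrom 0 (desW (x ∷ w)))

ω-C : ∀ x w → ω (C (x ∷ w)) ≡ fromDesc (map not (reverse (desW (x ∷ w))))
ω-C x w with C (x ∷ w) | fromDescFrom-∷ 1 (desW (x ∷ w)) | descSet-fromDescFrom 0 (desW (x ∷ w))
... | _ | a , α , refl | eq = cong (fromDesc ∘ map not) (trans (descSet-reverse (a ∷ α)) (cong reverse eq))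

desW-take : ∀ i w → desW (take (suc i) w) ≡ take i (desW w)
desW-take zero    []          = refl
desW-take (suc i) []          = refl
desW-take zero    (x ∷ [])    = refl
desW-take (suc i) (x ∷ [])    = refl
desW-take zero    (x ∷ y ∷ w) = refl
desW-take (suc i) (x ∷ y ∷ w) = cong ((y <ᵇ x) ∷_) (desW-take i (y ∷ w))

desW-drop : ∀ i w → desW (drop i w) ≡ drop i (desW w)
desW-drop zero    w           = refl
desW-drop (suc i) []          = refl
desW-drop (suc i) (x ∷ y ∷ w) = desW-drop i (y ∷ w)
desW-drop (suc zero)    (x ∷ []) = refl
desW-drop (suc (suc i)) (x ∷ []) = refl

-- The lengths tell the empty word from one-letter words, whose descent lists are also empty.
C-cong : ∀ w w′ → length w ≡ length w′ → desW w ≡ desW w′ → C w ≡ C w′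
C-cong []      []        _ _  = refl
C-cong (_ ∷ _) (_ ∷ _)   _ eq = cong fromDesc eq

module _ {w w′ : Word} (len : length w ≡ length w′) (des≡ : desW w ≡ desW w′) where

  -- To be used for `wordOf (C w)` and `w`, different words with equal descents: corresponding
  -- factors have equal compositions, so the coproduct may be computed from any word.
  C-take : ∀ i → C (take i w) ≡ C (take i w′)
  C-take zero    = refl
  C-take (suc i) = C-cong (take (suc i) w) (take (suc i) w′)
    (trans (length-take (suc i) w) (trans (cong (suc i ℕ.⊓_) len) (sym (length-take (suc i) w′))))
    (trans (desW-take i w) (trans (cong (take i) des≡) (sym (desW-take i w′))))

  C-drop : ∀ i → C (drop i w) ≡ C (drop i w′)
  C-drop i = C-cong (drop i w) (drop i w′)
    (trans (length-drop i w) (trans (cong (_∸ i) len) (sym (length-drop i w′))))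
    (trans (desW-drop i w) (trans (cong (drop i) des≡) (sym (desW-drop i w′))))

-- The given series, coproduct and product in terms of chains and convolution.

count-∑ : ∀ (p : A → Bool) xs → ℤ.+ count p xs ≡ ∑ xs (λ x → ⟦ p x ⟧)
count-∑ p []       = refl
count-∑ p (x ∷ xs) with p x
... | true  = cong (1ℤ +_) (count-∑ p xs)
... | false = trans (count-∑ p xs) (sym (+-identityˡ _))

ppCount-chains : ∀ (r : A → A → Bool) w W bs m → length W ≡ length w → desW W ≡ des r w → length bs ≡ length m →
  ℤ.+ ppCount W (boxes bs) m ≡ chains r bs m w
ppCount-chains r w W bs m len des≡ len-bs = begin
  ℤ.+ ppCount W (boxes bs) m
    ≡⟨ count-∑ _ (tuples (length W) (boxes bs)) ⟩
  ∑ (tuples (length W) (boxes bs)) (λ σ → ⟦ ne σ ∧ (chainOK (desW W) σ ∧ eqVec (vsumAll (length m) σ) m) ⟧)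
    ≡⟨ ∑-cong (tuples (length W) (boxes bs)) (λ σ → trans
         (cong ⟦_⟧ (trans (sym (∧-assoc (ne σ) (chainOK (desW W) σ) _)) (cong (_∧ eqVec (vsumAll (length m) σ) m) (valid-correct (desW W) σ))))
         (⟦∧⟧ (valid (desW W) σ) _)) ⟩
  sumOver (length W) (desW W) (length m)
    ≡⟨ cong₂ (λ n ds → sumOver n ds (length m)) len des≡ ⟩
  sumOver (length w) (des r w) (length m)
    ≡⟨ cong (sumOver (length w) (des r w)) len-bs ⟨
  chains r bs m w ∎
  where
  open ≡-Reasoning
  ne : List (List ℕ) → Bool
  ne = foldr (λ s r → nonempty s ∧ r) true
  sumOver : ℕ → List Bool → ℕ → ℤ
  sumOver n ds k = ∑ (tuples n (boxes bs)) (λ σ → ⟦ valid ds σ ⟧ * ⟦ eqVec (vsumAll k σ) m ⟧)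

descent : ℕ → ℕ → Bool
descent x y = y <ᵇ x

desW-des : ∀ w → desW w ≡ des descent w
desW-des []          = refl
desW-des (x ∷ [])    = refl
desW-des (x ∷ y ∷ w) = cong ((y <ᵇ x) ∷_) (desW-des (y ∷ w))

Ltil-C : ∀ w m → Ltil (C w) m ≡ setChains descent w m
Ltil-C w m = ppCount-chains descent w (wordOf (C w)) (replicate (length m) 1) m
  (length-wordOf-C w) (trans (desW-wordOf-C w) (desW-des w)) (length-replicate (length m))

-- Reading the reversed word with `_ᵒ` reverses and complements the descent list, which is what `ω`
-- does to the descent set.
Lhat-ω-C : ∀ w m → Lhat (ω (C w)) m ≡ multisetChains (descent ᵒ) (reverse w) m
Lhat-ω-C []      m = ppCount-chains (descent ᵒ) [] [] m m refl refl refl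
Lhat-ω-C (x ∷ w) m = trans (cong (λ α → Lhat α m) (ω-C x w))
  (ppCount-chains (descent ᵒ) (reverse (x ∷ w)) (wordOf (fromDesc ds)) m m len des≡ refl)
  where
  ds = map not (reverse (desW (x ∷ w)))
  len : length (wordOf (fromDesc ds)) ≡ length (reverse (x ∷ w))
  len = begin
    length (wordOf (fromDesc ds))           ≡⟨ length-wordOf (fromDesc ds) ⟩
    size (fromDesc ds)                      ≡⟨ size-fromDescFrom 1 ds ⟩
    suc (length ds)                         ≡⟨ cong suc (length-map not (reverse (desW (x ∷ w)))) ⟩
    suc (length (reverse (desW (x ∷ w))))   ≡⟨ cong suc (length-reverse (desW (x ∷ w))) ⟩
    suc (length (desW (x ∷ w)))             ≡⟨ cong suc (length-desW x w) ⟩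
    length (x ∷ w)                          ≡⟨ length-reverse (x ∷ w) ⟨
    length (reverse (x ∷ w))                ∎
    where open ≡-Reasoning
  des≡ : desW (wordOf (fromDesc ds)) ≡ des (descent ᵒ) (reverse (x ∷ w))
  des≡ = begin
    desW (wordOf (fromDesc ds))              ≡⟨ desW-wordOf (fromDesc ds) (IsComp-fromDescFrom 0 ds) ⟩
    descSet (fromDesc ds)                    ≡⟨ descSet-fromDescFrom 0 ds ⟩
    ds                                       ≡⟨ cong (map not ∘ reverse) (desW-des (x ∷ w)) ⟩
    map not (reverse (des descent (x ∷ w)))  ≡⟨ des-reverse descent (x ∷ w) ⟨
    des (descent ᵒ) (reverse (x ∷ w))        ∎
    where open ≡-Reasoning

negVars-Lhat-ω-C : ∀ w m → negVars (Lhat (ω (C w))) m ≡ antipodeChains descent w m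
negVars-Lhat-ω-C w m = trans (negVars-sgn (Lhat (ω (C w))) m) (cong (sgn (sum m) *_) (Lhat-ω-C w m))

-- The terms with index 0 of the two families are the cuts before and at the first letter; the
-- remaining ones are the cuts of the tail with that letter put back.
∑-cuts : ∀ w (φ : Word → Word → ℤ) →
  ∑ (upTo (suc (length w))) (λ i → φ (take i w) (drop i w)) + ∑ (upTo (length w)) (λ i → φ (take (suc i) w) (drop i w)) ≡
  ∑₂ (wordCuts w) φ
∑-cuts []      φ = +-identityʳ _
∑-cuts (x ∷ w) φ = begin
  ∑ (upTo (suc (suc n))) (λ i → φ (take i (x ∷ w)) (drop i (x ∷ w))) + ∑ (upTo (suc n)) (λ i → φ (x ∷ take i w) (drop i (x ∷ w)))
    ≡⟨ cong₂ _+_ (∑-upTo-suc (suc n) (λ i → φ (take i (x ∷ w)) (drop i (x ∷ w)))) (∑-upTo-suc n (λ i → φ (x ∷ take i w) (drop i (x ∷ w)))) ⟩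
  (φ [] (x ∷ w) + a) + (φ [ x ] (x ∷ w) + b)
    ≡⟨ regroup (φ [] (x ∷ w)) a (φ [ x ] (x ∷ w)) b ⟩
  φ [] (x ∷ w) + (φ [ x ] (x ∷ w) + (a + b))
    ≡⟨ cong (λ z → φ [] (x ∷ w) + (φ [ x ] (x ∷ w) + z)) (∑-cuts w (λ u u′ → φ (x ∷ u) u′)) ⟩
  φ [] (x ∷ w) + (φ [ x ] (x ∷ w) + ∑₂ (wordCuts w) (λ u u′ → φ (x ∷ u) u′))
    ≡⟨ ∑-wordCuts-∷ x w φ ⟨
  ∑₂ (wordCuts (x ∷ w)) φ ∎
  where
  open ≡-Reasoning
  n = length w
  a = ∑ (upTo (suc n)) (λ i → φ (x ∷ take i w) (drop i w))
  b = ∑ (upTo n) (λ i → φ (x ∷ take (suc i) w) (drop i w))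
  regroup : ∀ p a q b → (p + a) + (q + b) ≡ p + (q + (a + b))
  regroup = solve-∀

∑-cuts-wordOf-C : ∀ w (φ : Comp → Comp → ℤ) →
  ∑ (cuts (wordOf (C w))) (λ p → φ (C (proj₁ p)) (C (proj₂ p))) ≡ ∑₂ (wordCuts w) (λ u u′ → φ (C u) (C u′))
∑-cuts-wordOf-C w φ = begin
  ∑ (cuts W) (λ p → φ (C (proj₁ p)) (C (proj₂ p)))
    ≡⟨ ∑-++ (map (λ i → take i W , drop i W) (upTo (suc (length W)))) (map (λ i → take (suc i) W , drop i W) (upTo (length W))) φC ⟩
  ∑ (map (λ i → take i W , drop i W) (upTo (suc (length W)))) φC + ∑ (map (λ i → take (suc i) W , drop i W) (upTo (length W))) φC
    ≡⟨ cong₂ _+_ (∑-map _ (upTo (suc (length W))) φC) (∑-map _ (upTo (length W)) φC) ⟩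
  ∑ (upTo (suc (length W))) (λ i → φ (C (take i W)) (C (drop i W))) + ∑ (upTo (length W)) (λ i → φ (C (take (suc i) W)) (C (drop i W)))
    ≡⟨ cong₂ _+_ (∑-cong (upTo (suc (length W))) (λ i → cong₂ φ (C-take len des≡ i) (C-drop len des≡ i)))
                 (∑-cong (upTo (length W)) (λ i → cong₂ φ (C-take len des≡ (suc i)) (C-drop len des≡ i))) ⟩
  ∑ (upTo (suc (length W))) (λ i → φ (C (take i w)) (C (drop i w))) + ∑ (upTo (length W)) (λ i → φ (C (take (suc i) w)) (C (drop i w)))
    ≡⟨ cong (λ n → ∑ (upTo (suc n)) (λ i → φ (C (take i w)) (C (drop i w))) + ∑ (upTo n) (λ i → φ (C (take (suc i) w)) (C (drop i w)))) len ⟩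
  ∑ (upTo (suc (length w))) (λ i → φ (C (take i w)) (C (drop i w))) + ∑ (upTo (length w)) (λ i → φ (C (take (suc i) w)) (C (drop i w)))
    ≡⟨ ∑-cuts w (λ u u′ → φ (C u) (C u′)) ⟩
  ∑₂ (wordCuts w) (λ u u′ → φ (C u) (C u′)) ∎
  where
  open ≡-Reasoning
  W = wordOf (C w)
  len : length W ≡ length w
  len = length-wordOf-C w
  des≡ : desW W ≡ desW w
  des≡ = desW-wordOf-C w
  φC : Word × Word → ℤ
  φC p = φ (C (proj₁ p)) (C (proj₂ p))

∑-upTo-splits : ∀ e (φ : ℕ → ℕ → ℤ) → ∑ (upTo (suc e)) (λ i → φ i (e ∸ i)) ≡ ∑₂ (splits e) φ
∑-upTo-splits zero    φ = refl
∑-upTo-splits (suc e) φ = begin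
  ∑ (upTo (suc (suc e))) (λ i → φ i (suc e ∸ i))                   ≡⟨ ∑-upTo-suc (suc e) (λ i → φ i (suc e ∸ i)) ⟩
  φ 0 (suc e) + ∑ (upTo (suc e)) (λ i → φ (suc i) (e ∸ i))         ≡⟨ cong (φ 0 (suc e) +_) (∑-upTo-splits e (φ ∘ suc)) ⟩
  φ 0 (suc e) + ∑₂ (splits e) (λ i j → φ (suc i) j)                ≡⟨ ∑-splits-suc e φ ⟨
  ∑₂ (splits (suc e)) φ                                            ∎
  where open ≡-Reasoning

∑-boxes-boxSplits : ∀ m (φ : Monomial → Monomial → ℤ) → ∑ (boxes m) (λ v → φ v (vsub m v)) ≡ ∑₂ (boxSplits m) φ
∑-boxes-boxSplits []      φ = refl
∑-boxes-boxSplits (e ∷ m) φ = begin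
  ∑ (boxes (e ∷ m)) (λ v → φ v (vsub (e ∷ m) v))
    ≡⟨ ∑-boxes-∷ e m (λ v → φ v (vsub (e ∷ m) v)) ⟩
  ∑ (boxes m) (λ v → ∑ (upTo (suc e)) (λ i → φ (i ∷ v) (e ∸ i ∷ vsub m v)))
    ≡⟨ ∑-swap (boxes m) (upTo (suc e)) (λ v i → φ (i ∷ v) (e ∸ i ∷ vsub m v)) ⟩
  ∑ (upTo (suc e)) (λ i → ∑ (boxes m) (λ v → φ (i ∷ v) (e ∸ i ∷ vsub m v)))
    ≡⟨ ∑-cong (upTo (suc e)) (λ i → ∑-boxes-boxSplits m (λ v v′ → φ (i ∷ v) (e ∸ i ∷ v′))) ⟩
  ∑ (upTo (suc e)) (λ i → ∑₂ (boxSplits m) (λ v v′ → φ (i ∷ v) (e ∸ i ∷ v′)))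
    ≡⟨ ∑-upTo-splits e (λ i j → ∑₂ (boxSplits m) (λ v v′ → φ (i ∷ v) (j ∷ v′))) ⟩
  ∑₂ (splits e) (λ i j → ∑₂ (boxSplits m) (λ v v′ → φ (i ∷ v) (j ∷ v′)))
    ≡⟨ ∑-boxSplits-∷ e m φ ⟨
  ∑₂ (boxSplits (e ∷ m)) φ ∎
  where open ≡-Reasoning

-- Applying the axiom at `C w` for every word `w` turns it into an identity between functions on
-- words and monomials.
antipode-inverse : ∀ S → IsAntipode S → ∀ w m → (setChains descent ⋆ (S ∘ C)) w m ≡ δ w m
antipode-inverse S S-antipode w m = begin
  (setChains descent ⋆ (S ∘ C)) w m
    ≡⟨ ⋆-congʳ (S ∘ C) Ltil-C w m ⟨
  ((Ltil ∘ C) ⋆ (S ∘ C)) w m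
    ≡⟨ ∑₂-cong (wordCuts w) (λ u u′ → ∑-boxes-boxSplits m (λ v v′ → Ltil (C u) v * S (C u′) v′)) ⟨
  ∑₂ (wordCuts w) (λ u u′ → (Ltil (C u) ⊛ S (C u′)) m)
    ≡⟨ ∑-cuts-wordOf-C w (λ α β → (Ltil α ⊛ S β) m) ⟨
  ∑ (cuts (wordOf (C w))) (λ p → (Ltil (C (proj₁ p)) ⊛ S (C (proj₂ p))) m)
    ≡⟨ ∑-map (λ p → Ltil (C (proj₁ p)) ⊛ S (C (proj₂ p))) (cuts (wordOf (C w))) (λ f → f m) ⟨
  ΣPS (map (λ p → Ltil (C (proj₁ p)) ⊛ S (C (proj₂ p))) (cuts (wordOf (C w)))) m
    ≡⟨ IsAntipode.right S-antipode (C w) (IsComp-C w) m ⟩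
  Ltil (C w) [] * onePS m
    -- Without variables no value is nonempty, so the constant term is 1 for the empty word and 0
    -- for all others.
    ≡⟨ cong (_* onePS m) (trans (Ltil-C w []) (chains-[] descent w)) ⟩
  δ w m ∎
  where open ≡-Reasoning

theorem5p6 : (S : Comp → PS) → IsAntipode S →
    ∀ (α : Comp) → IsComp α → ∀ (m : Monomial) →
    S α m ≡ negVars (Lhat (ω α)) m
theorem5p6 S S-antipode α α-comp m = begin
  S α m                          ≡⟨ cong (λ β → S β m) (C-wordOf α α-comp) ⟨
  S (C w) m                      ≡⟨ ⋆-inverse-unique (antipodeChains descent) (setChains descent) (S ∘ C)
                                      (λ w m → antipodeChains-inverse descent m w) (antipode-inverse S S-antipode) w m ⟩
  antipodeChains descent w m     ≡⟨ negVars-Lhat-ω-C w m ⟨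
  negVars (Lhat (ω (C w))) m     ≡⟨ cong (λ β → negVars (Lhat (ω β)) m) (C-wordOf α α-comp) ⟩
  negVars (Lhat (ω α)) m         ∎
  where
  open ≡-Reasoning
  w = wordOf α
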